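{- Let $f,g$ be non-negative integers. Then in $M^{(f,g)}$, \[\sum_{\mu\in\mathcal P_{f,g}}t_\mu m=\sum_{\lambda\in\mathcal P_{f,g}}F(\lambda)\,s_\lambda m.\]
   Context: $\mathbb F$ is any field, $k=f+g$, $\mathfrak S_k$ has Coxeter generators $t_i=(i\ i{+}1)$ and $s_i=t_i-1\in\mathbb F\mathfrak S_k$. $M^{(f,g)}=\langle m\mid t_im=m\ (i\ne f)\rangle$ as an $\mathbb F\mathfrak S_k$-module. $\mathcal P_{f,g}$ is the set of partitions with at most $g$ nonzero parts, all at most $f$. For $\lambda\in\mathcal P_{f,g}$, $t_\lambda=\prod_{r=1}^{g}(t_{\lambda_r+g-r+1}t_{\lambda_r+g-r+2}\cdots t_{f+g-r})$ with $r=1$ leftmost (a factor is empty if $\lambda_r=f$), and $s_\lambda$ is the same formula with $t_i$ replaced by $s_i$. The function $F$ on partitions is defined recursively: $F(\varnothing)=1$; for $\lambda\ne\varnothing$ choose a node $(a,b)$ of $\lambda$ (i.e. $b\le\lambda_a$) with $a+b$ maximal, and set $F(\lambda)=\binom{a+b}{a}F((\lambda_{a+1},\lambda_{a+2},\dots))\,F((\max\{\lambda_1-b,0\},\max\{\lambda_2-b,0\},\dots))$; this does not depend on the choice of $(a,b)$. The integer $F(\lambda)$ is regarded as an element of $\mathbb F$. -}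

module Defs where

open import Level using (_⊔_; 0ℓ) renaming (suc to lsuc)
open import Algebra.Bundles using (CommutativeRing; Ring; Group)
open import Algebra.Structures using (IsRing)
open import Algebra.Module.Bundles using (LeftModule)
import Algebra.Properties.Ring as RingProperties
import Algebra.Properties.CommutativeSemigroup as CSProperties
import Algebra.Properties.AbelianGroup as AbelianGroupProperties
open import Data.Bool.Base using (if_then_else_)
open import Data.List.Base as List using (List; []; _∷_; _++_; foldr; cartesianProductWith; deduplicate)
import Data.List.Membership.Setoid as SetoidMembership
import Data.List.Membership.Setoid.Properties as SetoidMembershipProperties
import Data.List.Relation.Unary.Unique.Setoid as SetoidUnique
import Data.List.Relation.Unary.Unique.DecSetoid.Properties as DecSetoidUnique
open import Data.List.Relation.Unary.Any using (here; there)
open import Data.List.Relation.Unary.AllPairs using ([]; _∷_)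
open import Data.List.Relation.Unary.All as All using (All; []; _∷_)
import Data.List.Relation.Unary.All.Properties as AllP
open import Data.Nat as ℕ using (ℕ)
import Data.Nat.Properties as ℕ
open import Data.Vec.Base using (Vec; lookup; toList)
import Algebra.Properties.Semiring.Mult as SemiringMult
open import Data.Empty using (⊥-elim)
open import Data.Fin.Base using (Fin; fromℕ<; toℕ)
import Data.Fin.Properties as Fin
open import Data.Fin.Permutation as Perm using (Permutation′; _⟨$⟩ʳ_; _∘ₚ_; flip)
open import Data.Product.Base using (∃-syntax; _×_; _,_; proj₂)
open import Relation.Binary.Bundles using (DecSetoid)
open import Relation.Binary.Core using (Rel)
open import Relation.Binary.Definitions using (Decidable)
open import Relation.Binary.PropositionalEquality as ≡ using (_≡_)
import Relation.Binary.Reasoning.Setoid as SetoidReasoning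
open import Relation.Nullary using (¬_; does; yes; no)

module Partitions where

  open import Data.Nat.Base using (ℕ; zero; suc; _+_; _*_; _∸_; _≤_; _<_; _≥_; _/_; z≤n; s≤s; s≤s⁻¹; _!)
  open import Data.Nat.Properties
  open import Data.Nat.Combinatorics.Specification using (nCk≡n!/k![n-k]!)
  open import Data.Nat.Combinatorics using (_C_; k![n∸k]!∣n!)
  open import Data.Nat.DivMod using (m/n*n≡m)
  open import Data.Nat.Induction using (<-wellFounded)
  open import Data.Nat.Tactic.RingSolver using (solve-∀)
  open import Induction.WellFounded using (Acc; acc)
  open import Data.List.Base as List using (List; []; _∷_; drop; length; concatMap; upTo)
  open import Data.Nat.ListAction using (sum)
  open import Data.List.Properties using (drop-drop; drop-map; map-∘; map-cong; length-map)
  open import Data.List.Membership.Propositional using (_∈_; find; lose)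
  open import Data.List.Membership.Propositional.Properties using (∈-concatMap⁺; ∈-concatMap⁻; ∈-upTo⁺; ∈-upTo⁻; ∈-map⁺; ∈-map⁻)
  open import Data.List.Relation.Unary.Any using (here; there)
  import Data.List.Relation.Unary.All as ListAll
  import Data.List.Relation.Unary.All.Properties as ListAllP
  import Data.List.Relation.Unary.AllPairs.Properties as AllPairsP
  open import Data.List.Relation.Binary.Disjoint.Propositional using (Disjoint)
  open import Data.List.Relation.Unary.AllPairs as AllPairs using ([]; _∷_)
  open import Data.List.Relation.Unary.Unique.Propositional using (Unique)
  import Data.List.Relation.Unary.Unique.Propositional.Properties as Unique
  open import Data.Vec.Base using (Vec; []; _∷_)
  open import Data.Vec.Properties using (∷-injectiveˡ; ∷-injectiveʳ)
  open import Data.Vec.Relation.Unary.All as VecAll using ([]; _∷_)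
  open import Data.Vec.Relation.Unary.Linked using (Linked; []; [-]; _∷_)
  open import Data.Product.Base using (∃₂; _×_; _,_; proj₂)
  open import Data.Sum.Base using (_⊎_; inj₁; inj₂)
  open import Function.Bundles using (_⇔_; mk⇔)
  open import Relation.Binary.Definitions using (tri<; tri≈; tri>)
  open import Relation.Binary.PropositionalEquality
  open import Relation.Nullary using (¬_; yes; no)

  -- A partition is given by the list (λ₁, λ₂, …, λₗ) of its parts, with
  -- λᵢ = 0 for i > l; trailing zeros are allowed, so ∅ is any list of zeros.

  -- Node ν a b: the node in row a and column b, both counted from 1.
  data Node : List ℕ → ℕ → ℕ → Set where
    here  : ∀ {x xs b} → 1 ≤ b → b ≤ x → Node (x ∷ xs) 1 b
    there : ∀ {x xs a b} → Node xs a b → Node (x ∷ xs) (suc a) b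

  IsEmpty : List ℕ → Set
  IsEmpty ν = ∀ {a b} → ¬ Node ν a b

  record MaxNode (ν : List ℕ) (a b : ℕ) : Set where
    constructor _,_
    field
      node    : Node ν a b
      maximal : ∀ {c d} → Node ν c d → c + d ≤ a + b

  open MaxNode

  chooseNode : ∀ ν → IsEmpty ν ⊎ ∃₂ (MaxNode ν)
  chooseNode [] = inj₁ λ ()
  chooseNode (x ∷ ν) with x | chooseNode ν
  ... | zero  | inj₁ e = inj₁ λ { (here (s≤s _) ()) ; (there n) → e n }
  ... | zero  | inj₂ (a , b , n , max) = inj₂ (suc a , b , there n , λ
    { (here (s≤s _) ()) ; (there n′) → s≤s (max n′) })
  ... | suc y | inj₁ e = inj₂ (1 , suc y , here (s≤s z≤n) ≤-refl , λ
    { (here _ b≤x) → s≤s b≤x ; (there n) → ⊥-elim (e n) })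
  ... | suc y | inj₂ (a , b , n , max) with a + b ≤? suc y
  ...   | yes p = inj₂ (1 , suc y , here (s≤s z≤n) ≤-refl , λ
    { (here _ b≤x) → s≤s b≤x ; (there n′) → s≤s (≤-trans (max n′) p) })
  ...   | no ¬p = inj₂ (suc a , b , there n , λ
    { (here _ b≤x) → s≤s (≤-trans b≤x (<⇒≤ (≰⇒> ¬p))) ; (there n′) → s≤s (max n′) })

  _below_ : List ℕ → ℕ → List ℕ
  ν below a = drop a ν

  _rightOf_ : List ℕ → ℕ → List ℕ
  ν rightOf b = List.map (_∸ b) ν

  -- Decreases along the recursion for F.
  measure : List ℕ → ℕ
  measure ν = length ν + sum ν

  private
    sum-drop-≤ : ∀ a ν → sum (drop a ν) ≤ sum ν
    sum-drop-≤ zero    ν       = ≤-refl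
    sum-drop-≤ (suc a) []      = ≤-refl
    sum-drop-≤ (suc a) (x ∷ ν) = ≤-trans (sum-drop-≤ a ν) (m≤n+m _ x)

    sum-rightOf-≤ : ∀ b ν → sum (ν rightOf b) ≤ sum ν
    sum-rightOf-≤ b []      = ≤-refl
    sum-rightOf-≤ b (x ∷ ν) = +-mono-≤ (m∸n≤m x b) (sum-rightOf-≤ b ν)

    sum-rightOf-< : ∀ {ν a b} → Node ν a b → sum (ν rightOf b) < sum ν
    sum-rightOf-< {x ∷ ν} {b = suc b} (here _ (s≤s {n = y} _)) =
      +-mono-<-≤ (s≤s (m∸n≤m y b)) (sum-rightOf-≤ (suc b) ν)
    sum-rightOf-< {x ∷ ν} {b = b} (there n) = +-mono-≤-< (m∸n≤m x b) (sum-rightOf-< n)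

    length-below-< : ∀ {ν a b} → Node ν a b → length (ν below a) < length ν
    length-below-< (here _ _) = ≤-refl
    length-below-< (there n)  = m≤n⇒m≤1+n (length-below-< n)

  below-< : ∀ {ν a b} → Node ν a b → measure (ν below a) < measure ν
  below-< {ν} {a} n = +-mono-<-≤ (length-below-< n) (sum-drop-≤ a ν)

  rightOf-< : ∀ {ν a b} → Node ν a b → measure (ν rightOf b) < measure ν
  rightOf-< {ν} {b = b} n = +-mono-≤-< (≤-reflexive (length-map (_∸ b) ν)) (sum-rightOf-< n)

  private
    F-acc : ∀ ν → Acc _<_ (measure ν) → ℕ
    F-acc ν (acc rec) with chooseNode ν
    ... | inj₁ _ = 1
    ... | inj₂ (a , b , n , _) =
      ((a + b) C a) * F-acc (ν below a) (rec (below-< n)) * F-acc (ν rightOf b) (rec (rightOf-< n))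

  F : List ℕ → ℕ
  F ν = F-acc ν (<-wellFounded (measure ν))

  private
    step : List ℕ → ℕ → ℕ → ℕ
    step ν a b = ((a + b) C a) * F (ν below a) * F (ν rightOf b)

    F-acc-irr : ∀ ν (p q : Acc _<_ (measure ν)) → F-acc ν p ≡ F-acc ν q
    F-acc-irr ν (acc p) (acc q) with chooseNode ν
    ... | inj₁ _ = refl
    ... | inj₂ (a , b , n , _) = cong₂ (λ y z → ((a + b) C a) * y * z)
      (F-acc-irr (ν below a) (p (below-< n)) (q (below-< n)))
      (F-acc-irr (ν rightOf b) (p (rightOf-< n)) (q (rightOf-< n)))

    F-acc-choose : ∀ ν (p : Acc _<_ (measure ν)) →
      IsEmpty ν × F-acc ν p ≡ 1 ⊎ ∃₂ λ a b → MaxNode ν a b × F-acc ν p ≡ step ν a b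
    F-acc-choose ν (acc p) with chooseNode ν
    ... | inj₁ e = inj₁ (e , refl)
    ... | inj₂ (a , b , n , m) = inj₂ (a , b , (n , m) , cong₂ (λ y z → ((a + b) C a) * y * z)
      (F-acc-irr (ν below a) (p (below-< n)) _) (F-acc-irr (ν rightOf b) (p (rightOf-< n)) _))

  F-∅ : ∀ {ν} → IsEmpty ν → F ν ≡ 1
  F-∅ {ν} e with F-acc-choose ν (<-wellFounded (measure ν))
  ... | inj₁ (_ , eq) = eq
  ... | inj₂ (_ , _ , (n , _) , _) = ⊥-elim (e n)

  private
    below⁺ : ∀ {ν} a {c d} → 1 ≤ c → Node ν (a + c) d → Node (ν below a) c d
    below⁺ zero    _ n = n
    below⁺ (suc zero) () (here _ _)
    below⁺ (suc a) 1≤c (there n) = below⁺ a 1≤c n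

    below⁻ : ∀ ν a {c d} → Node (ν below a) c d → Node ν (a + c) d
    below⁻ ν       zero    n = n
    below⁻ (x ∷ ν) (suc a) n = there (below⁻ ν a n)

    rightOf⁺ : ∀ {ν} d {a e} → 1 ≤ e → Node ν a (e + d) → Node (ν rightOf d) a e
    rightOf⁺ {x ∷ _} d {e = e} 1≤e (here _ p) = here 1≤e (m+n≤o⇒m≤o∸n e p)
    rightOf⁺ d 1≤e (there n)  = there (rightOf⁺ d 1≤e n)

    rightOf⁻ : ∀ ν d {a e} → Node (ν rightOf d) a e → Node ν a (e + d)
    rightOf⁻ (x ∷ ν) d {e = suc e} (here _ p) =
      here (s≤s z≤n) (m≤o∸n⇒m+n≤o (suc e) (<⇒≤ (m∸n≢0⇒n<m (>⇒≢ (≤-trans (s≤s z≤n) p)))) p)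
    rightOf⁻ (x ∷ ν) d (there n) = there (rightOf⁻ ν d n)

    C-! : ∀ m n → ((m + n) C m) * (m ! * n !) ≡ (m + n) !
    C-! m n = begin
      ((m + n) C m) * (m ! * n !)  ≡⟨ cong (λ o → ((m + n) C m) * (m ! * o !)) (sym (m+n∸m≡n m n)) ⟩
      ((m + n) C m) * d            ≡⟨ cong (_* d) (nCk≡n!/k![n-k]! (m≤m+n m n)) ⟩
      ((m + n) ! / d) * d          ≡⟨ m/n*n≡m (k![n∸k]!∣n! (m≤m+n m n)) ⟩
      (m + n) !                    ∎
      where
      open ≡-Reasoning
      d = m ! * (m + n ∸ m) !
      instance d≢0 = m !* (m + n ∸ m) !≢0

    C-trinomial : ∀ a p d →
      ((a + (p + d)) C a) * ((p + d) C p) ≡ ((a + p + d) C (a + p)) * ((a + p) C a)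
    C-trinomial a p d = *-cancelʳ-≡ _ _ (a ! * (p ! * d !)) (begin
      ((a + (p + d)) C a) * ((p + d) C p) * (a ! * (p ! * d !))
        ≡⟨ lemma₁ ((a + (p + d)) C a) ((p + d) C p) (a !) (p ! * d !) ⟩
      ((a + (p + d)) C a) * (a ! * (((p + d) C p) * (p ! * d !)))
        ≡⟨ cong (λ z → ((a + (p + d)) C a) * (a ! * z)) (C-! p d) ⟩
      ((a + (p + d)) C a) * (a ! * (p + d) !)
        ≡⟨ C-! a (p + d) ⟩
      (a + (p + d)) !
        ≡⟨ cong _! (sym (+-assoc a p d)) ⟩
      (a + p + d) !
        ≡⟨ C-! (a + p) d ⟨
      ((a + p + d) C (a + p)) * ((a + p) ! * d !)
        ≡⟨ cong (λ z → ((a + p + d) C (a + p)) * (z * d !)) (C-! a p) ⟨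
      ((a + p + d) C (a + p)) * (((a + p) C a) * (a ! * p !) * d !)
        ≡⟨ lemma₂ ((a + p + d) C (a + p)) ((a + p) C a) (a !) (p !) (d !) ⟩
      ((a + p + d) C (a + p)) * ((a + p) C a) * (a ! * (p ! * d !)) ∎)
      where
      open ≡-Reasoning
      instance nz = m*n≢0 (a !) (p ! * d !) {{a !≢0}} {{p !* d !≢0}}
      lemma₁ : ∀ x y z w → x * y * (z * w) ≡ x * (z * (y * w))
      lemma₁ = solve-∀
      lemma₂ : ∀ x y u v w → x * (y * (u * v) * w) ≡ x * y * (u * (v * w))
      lemma₂ = solve-∀

    MaxStep : List ℕ → Set
    MaxStep ν = ∀ {a b} → MaxNode ν a b → F ν ≡ step ν a b

    step-exchange : ∀ ν a p d → 1 ≤ p → (∀ μ → measure μ < measure ν → MaxStep μ) →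
      MaxNode ν a (p + d) → MaxNode ν (a + p) d → step ν a (p + d) ≡ step ν (a + p) d
    step-exchange ν a p d 1≤p ih (n , max) (n′ , max′) = begin
      ((a + (p + d)) C a) * F (ν below a) * F (ν rightOf (p + d))
        ≡⟨ cong (λ z → ((a + (p + d)) C a) * z * F (ν rightOf (p + d)))
             (ih (ν below a) (below-< n) {p} {d} (below⁺ a 1≤p n′ , max-below)) ⟩
      ((a + (p + d)) C a) * (((p + d) C p) * X * Y) * Z
        ≡⟨ shuffle ((a + (p + d)) C a) ((p + d) C p) X Y Z ⟩
      ((a + (p + d)) C a) * ((p + d) C p) * X * Y * Z
        ≡⟨ cong (λ z → z * X * Y * Z) (C-trinomial a p d) ⟩
      ((a + p + d) C (a + p)) * ((a + p) C a) * X * Y * Z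
        ≡⟨ shuffle′ ((a + p + d) C (a + p)) ((a + p) C a) X Y Z ⟩
      ((a + p + d) C (a + p)) * X * (((a + p) C a) * Y * Z)
        ≡⟨ cong₂ (λ x z → ((a + p + d) C (a + p)) * F x * (((a + p) C a) * Y * F z)) (drop-drop a p ν) eqZ ⟩
      ((a + p + d) C (a + p)) * F (ν below (a + p)) *
        (((a + p) C a) * Y * F ((ν rightOf d) rightOf p))
        ≡⟨ cong (λ y → ((a + p + d) C (a + p)) * F (ν below (a + p)) *
             (((a + p) C a) * F y * F ((ν rightOf d) rightOf p))) (drop-map a ν) ⟨
      ((a + p + d) C (a + p)) * F (ν below (a + p)) * step (ν rightOf d) a p
        ≡⟨ cong (((a + p + d) C (a + p)) * F (ν below (a + p)) *_)
             (ih (ν rightOf d) (rightOf-< n′) {a} {p} (rightOf⁺ d 1≤p n , max-right)) ⟨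
      ((a + p + d) C (a + p)) * F (ν below (a + p)) * F (ν rightOf d) ∎
      where
      open ≡-Reasoning
      X = F ((ν below a) below p)
      Y = F ((ν below a) rightOf d)
      Z = F (ν rightOf (p + d))
      max-below : ∀ {c e} → Node (ν below a) c e → c + e ≤ p + d
      max-below {c} {e} q = +-cancelˡ-≤ a _ _ (subst (_≤ a + (p + d)) (+-assoc a c e) (max (below⁻ ν a q)))
      max-right : ∀ {c e} → Node (ν rightOf d) c e → c + e ≤ a + p
      max-right {c} {e} q = +-cancelʳ-≤ d _ _ (subst (_≤ a + p + d) (sym (+-assoc c e d)) (max′ (rightOf⁻ ν d q)))
      eqZ : ν rightOf (p + d) ≡ (ν rightOf d) rightOf p
      eqZ = trans (map-cong (λ x → trans (cong (x ∸_) (+-comm p d)) (sym (∸-+-assoc x d p))) ν) (map-∘ ν)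
      shuffle : ∀ u v x y z → u * (v * x * y) * z ≡ u * v * x * y * z
      shuffle = solve-∀
      shuffle′ : ∀ u v x y z → u * v * x * y * z ≡ u * x * (v * y * z)
      shuffle′ = solve-∀

    step-unique-< : ∀ ν {a b c d} → a < c → (∀ μ → measure μ < measure ν → MaxStep μ) →
      MaxNode ν a b → MaxNode ν c d → step ν a b ≡ step ν c d
    step-unique-< ν {a} {b} {c} {d} a<c ih m m′ with m≤n⇒∃[o]m+o≡n a<c
    ... | o , refl = lemma m m′ b≡
      where
      a+b≡c+d : a + b ≡ suc (a + o) + d
      a+b≡c+d = ≤-antisym (maximal m′ (node m)) (maximal m (node m′))
      b≡ : b ≡ suc o + d
      b≡ = +-cancelˡ-≡ a _ _ (trans a+b≡c+d (trans (cong (_+ d) (sym (+-suc a o))) (+-assoc a (suc o) d)))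
      lemma : ∀ {b} → MaxNode ν a b → MaxNode ν (suc (a + o)) d → b ≡ suc o + d →
        step ν a b ≡ step ν (suc (a + o)) d
      lemma m m′ refl = trans
        (step-exchange ν a (suc o) d (s≤s z≤n) ih m (subst (λ c → MaxNode ν c d) (sym (+-suc a o)) m′))
        (cong (λ c → step ν c d) (+-suc a o))

    step-unique : ∀ ν {a b c d} → (∀ μ → measure μ < measure ν → MaxStep μ) →
      MaxNode ν a b → MaxNode ν c d → step ν a b ≡ step ν c d
    step-unique ν {a} {b} {c} {d} ih m m′ with <-cmp a c
    ... | tri< a<c _ _ = step-unique-< ν a<c ih m m′
    ... | tri> _ _ c<a = sym (step-unique-< ν c<a ih m′ m)
    ... | tri≈ _ refl _ = cong (step ν a) (+-cancelˡ-≡ a b d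
      (≤-antisym (maximal m′ (node m)) (maximal m (node m′))))

    F-step-acc : ∀ ν → Acc _<_ (measure ν) → MaxStep ν
    F-step-acc ν (acc rec) m with F-acc-choose ν (<-wellFounded (measure ν))
    ... | inj₁ (e , _) = ⊥-elim (e (node m))
    ... | inj₂ (_ , _ , m′ , eq) = trans eq (step-unique ν (λ μ μ<ν → F-step-acc μ (rec μ<ν)) m′ m)

  -- The recursion holds for every node with a + b maximal, so F does not
  -- depend on the choice made by chooseNode.
  F-step : ∀ ν {a b} → MaxNode ν a b → F ν ≡ ((a + b) C a) * F (ν below a) * F (ν rightOf b)
  F-step ν = F-step-acc ν (<-wellFounded (measure ν))

  -- A partition with at most g nonzero parts is padded with zeros to exactly g
  -- parts.
  IsBoxPartition : ℕ → ∀ {g} → Vec ℕ g → Set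
  IsBoxPartition f ν = Linked _≥_ ν × VecAll.All (_≤ f) ν

  -- Enumerated by the value x ≤ f of the first part; ∈𝒫⇔ and 𝒫-unique show that
  -- each partition in the box is listed exactly once.
  𝒫 : ℕ → (g : ℕ) → List (Vec ℕ g)
  𝒫 f zero    = [] ∷ []
  𝒫 f (suc g) = concatMap (λ x → List.map (x ∷_) (𝒫 x g)) (upTo (suc f))

  private
    linked⁺ : ∀ {g x} {ν : Vec ℕ g} → IsBoxPartition x ν → Linked _≥_ (x ∷ ν)
    linked⁺ ([] , _) = [-]
    linked⁺ ([-] , p ∷ _) = p ∷ [-]
    linked⁺ (q ∷ l , p ∷ _) = p ∷ (q ∷ l)

    linked⁻ : ∀ {g x} {ν : Vec ℕ g} → Linked _≥_ (x ∷ ν) → IsBoxPartition x ν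
    linked⁻ [-] = [] , []
    linked⁻ {ν = y ∷ ν} (p ∷ l) = l , p ∷ VecAll.map (λ q → ≤-trans q p) (proj₂ (linked⁻ l))

    𝒫⁺ : ∀ f {g} {ν : Vec ℕ g} → IsBoxPartition f ν → ν ∈ 𝒫 f g
    𝒫⁺ f {zero}  {[]}    _           = here refl
    𝒫⁺ f {suc g} {x ∷ ν} (l , p ∷ _) = ∈-concatMap⁺ (λ x → List.map (x ∷_) (𝒫 x g))
      (lose (∈-upTo⁺ (s≤s p)) (∈-map⁺ (x ∷_) (𝒫⁺ x (linked⁻ l))))

    𝒫⁻ : ∀ f {g} {ν : Vec ℕ g} → ν ∈ 𝒫 f g → IsBoxPartition f ν
    𝒫⁻ f {zero}  (here refl) = [] , []
    𝒫⁻ f {suc g} ν∈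
      with x , x∈ , ν∈′ ← find (∈-concatMap⁻ (λ x → List.map (x ∷_) (𝒫 x g)) {xs = upTo (suc f)} ν∈)
      with ν , ν∈″ , refl ← ∈-map⁻ (x ∷_) ν∈′
      with x≤f ← s≤s⁻¹ (∈-upTo⁻ x∈)
      with b ← 𝒫⁻ x ν∈″
      = linked⁺ b , x≤f ∷ VecAll.map (λ q → ≤-trans q x≤f) (proj₂ b)

  ∈𝒫⇔ : ∀ f {g} {ν : Vec ℕ g} → ν ∈ 𝒫 f g ⇔ IsBoxPartition f ν
  ∈𝒫⇔ f = mk⇔ (𝒫⁻ f) (𝒫⁺ f)

  𝒫-unique : ∀ f g → Unique (𝒫 f g)
  𝒫-unique f zero    = ListAll.[] ∷ []
  𝒫-unique f (suc g) = Unique.concat⁺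
    (ListAllP.map⁺ (ListAll.universal (λ x → Unique.map⁺ ∷-injectiveʳ (𝒫-unique x g)) (upTo (suc f))))
    (AllPairsP.map⁺ (AllPairs.map disjoint (Unique.upTo⁺ (suc f))))
    where
    disjoint : ∀ {x y} → x ≢ y → Disjoint (List.map (x ∷_) (𝒫 x g)) (List.map (y ∷_) (𝒫 y g))
    disjoint {x} {y} x≢y (p , q)
      with _ , _ , refl ← ∈-map⁻ (x ∷_) p
      with _ , _ , eq ← ∈-map⁻ (y ∷_) q
      = x≢y (∷-injectiveˡ eq)

record Field c ℓ : Set (lsuc (c ⊔ ℓ)) where
  field
    commutativeRing : CommutativeRing c ℓ
  open CommutativeRing commutativeRing public
  field
    0≉1     : ¬ 0# ≈ 1#
    inverse : ∀ x → ¬ x ≈ 0# → ∃[ y ] x * y ≈ 1#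

module GroupAlgebra
  {c ℓ c′ ℓ′} (R : CommutativeRing c ℓ) (G : Group c′ ℓ′)
  (_≟_ : Decidable (Group._≈_ G))
  where

  private
    module R = CommutativeRing R
    module G = Group G

  -- An element Σ rᵢ gᵢ is a list of terms (rᵢ , gᵢ), in which the same group
  -- element may occur several times; equality compares coefficients.
  FormalSum : Set (c ⊔ c′)
  FormalSum = List (R.Carrier × G.Carrier)

  coeff : FormalSum → G.Carrier → R.Carrier
  coeff []            h = R.0#
  coeff ((r , g) ∷ x) h = (if does (g ≟ h) then r else R.0#) R.+ coeff x h

  infix 4 _≈_
  _≈_ : Rel FormalSum (ℓ ⊔ c′)
  x ≈ y = ∀ h → coeff x h R.≈ coeff y h

  infixl 6 _+_
  _+_ : FormalSum → FormalSum → FormalSum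
  _+_ = _++_

  infixl 7 _*_
  _*_ : FormalSum → FormalSum → FormalSum
  _*_ = cartesianProductWith λ (r , g) (s , h) → r R.* s , g G.∙ h

  -_ : FormalSum → FormalSum
  -_ = List.map λ (r , g) → R.- r , g

  0# : FormalSum
  0# = []

  single : R.Carrier → G.Carrier → FormalSum
  single r g = (r , g) ∷ []

  1# : FormalSum
  1# = single R.1# G.ε

  private
    open R using (setoid) renaming (Carrier to K)
    open SetoidReasoning setoid
    module RP = RingProperties R.ring
    module CS = CSProperties R.+-commutativeSemigroup
    module AG = AbelianGroupProperties R.+-abelianGroup

    decSetoid : DecSetoid c′ ℓ′
    decSetoid = record
      { isDecEquivalence = record { isEquivalence = G.isEquivalence ; _≟_ = _≟_ } }
    open SetoidMembership G.setoid using (_∈_)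
    open SetoidUnique G.setoid using (Unique)

    eval : FormalSum → (G.Carrier → K) → K
    eval []            φ = R.0#
    eval ((r , g) ∷ x) φ = r R.* φ g R.+ eval x φ

    Cong : (G.Carrier → K) → Set _
    Cong φ = ∀ {g h} → g G.≈ h → φ g R.≈ φ h

    eval-cong : ∀ x {φ ψ} → (∀ g → φ g R.≈ ψ g) → eval x φ R.≈ eval x ψ
    eval-cong []            _ = R.refl
    eval-cong ((r , g) ∷ x) e = R.+-cong (R.*-congˡ (e g)) (eval-cong x e)

    δ : G.Carrier → G.Carrier → K
    δ h g = if does (g ≟ h) then R.1# else R.0#

    δ-cong : ∀ h → Cong (δ h)
    δ-cong h {g} {g′} e with g ≟ h | g′ ≟ h
    ... | yes _ | yes _ = R.refl
    ... | no _  | no _  = R.refl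
    ... | yes p | no q  = ⊥-elim (q (G.trans (G.sym e) p))
    ... | no p  | yes q = ⊥-elim (p (G.trans e q))

    coeff-eval : ∀ x h → coeff x h R.≈ eval x (δ h)
    coeff-eval []            h = R.refl
    coeff-eval ((r , g) ∷ x) h with g ≟ h
    ... | yes _ = R.+-cong (R.sym (R.*-identityʳ r)) (coeff-eval x h)
    ... | no _  = R.+-cong (R.sym (R.zeroʳ r)) (coeff-eval x h)

    Σ-list : List G.Carrier → (G.Carrier → K) → K
    Σ-list []      φ = R.0#
    Σ-list (g ∷ L) φ = φ g R.+ Σ-list L φ

    Σ-cong : ∀ L {φ ψ} → (∀ g → φ g R.≈ ψ g) → Σ-list L φ R.≈ Σ-list L ψ
    Σ-cong []      e = R.refl
    Σ-cong (g ∷ L) e = R.+-cong (e g) (Σ-cong L e)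

    Σ-+ : ∀ L φ ψ → Σ-list L (λ g → φ g R.+ ψ g) R.≈ Σ-list L φ R.+ Σ-list L ψ
    Σ-+ []      φ ψ = R.sym (R.+-identityˡ R.0#)
    Σ-+ (g ∷ L) φ ψ = R.trans (R.+-congˡ (Σ-+ L φ ψ)) (CS.interchange _ _ _ _)

    Σ-0 : ∀ L {φ} → All (λ g → φ g R.≈ R.0#) L → Σ-list L φ R.≈ R.0#
    Σ-0 []      []       = R.refl
    Σ-0 (g ∷ L) (p ∷ ps) = R.trans (R.+-cong p (Σ-0 L ps)) (R.+-identityˡ R.0#)

    at : K → G.Carrier → G.Carrier → K
    at r g h = if does (g ≟ h) then r else R.0#

    Σ-at : ∀ {L} {φ} → Cong φ → ∀ r {g} → Unique L → g ∈ L →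
      Σ-list L (λ h → at r g h R.* φ h) R.≈ r R.* φ g
    Σ-at {h ∷ L} {φ} φ-cong r {g} (h∉ ∷ u) g∈ with g ≟ h
    ... | yes g≈h = begin
      r R.* φ h R.+ Σ-list L (λ h′ → at r g h′ R.* φ h′)
        ≈⟨ R.+-cong (R.*-congˡ (φ-cong (G.sym g≈h))) (Σ-0 L (All.map zero-at h∉)) ⟩
      r R.* φ g R.+ R.0#
        ≈⟨ R.+-identityʳ _ ⟩
      r R.* φ g ∎
      where
      zero-at : ∀ {h′} → ¬ h G.≈ h′ → at r g h′ R.* φ h′ R.≈ R.0#
      zero-at {h′} h≉h′ with g ≟ h′
      ... | yes g≈h′ = ⊥-elim (h≉h′ (G.trans (G.sym g≈h) g≈h′))
      ... | no _     = R.zeroˡ _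
    Σ-at {h ∷ L} {φ} φ-cong r {g} (h∉ ∷ u) (here g≈h) | no g≉h = ⊥-elim (g≉h g≈h)
    Σ-at {h ∷ L} {φ} φ-cong r {g} (h∉ ∷ u) (there g∈) | no g≉h = R.trans
      (R.+-cong (R.zeroˡ _) (Σ-at φ-cong r u g∈)) (R.+-identityˡ _)

    eval-Σ : ∀ L {φ} → Cong φ → Unique L → ∀ x → All (_∈ L) (List.map proj₂ x) →
      eval x φ R.≈ Σ-list L (λ h → coeff x h R.* φ h)
    eval-Σ L φ-cong u [] _ = R.sym (Σ-0 L (All.universal (λ _ → R.zeroˡ _) L))
    eval-Σ L {φ} φ-cong u ((r , g) ∷ x) (g∈ ∷ x∈) = begin
      r R.* φ g R.+ eval x φ
        ≈⟨ R.+-cong (R.sym (Σ-at φ-cong r u g∈)) (eval-Σ L φ-cong u x x∈) ⟩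
      Σ-list L (λ h → at r g h R.* φ h) R.+ Σ-list L (λ h → coeff x h R.* φ h)
        ≈⟨ Σ-+ L _ _ ⟨
      Σ-list L (λ h → at r g h R.* φ h R.+ coeff x h R.* φ h)
        ≈⟨ Σ-cong L (λ h → R.sym (R.distribʳ (φ h) (at r g h) (coeff x h))) ⟩
      Σ-list L (λ h → coeff ((r , g) ∷ x) h R.* φ h) ∎

    eval-≈ : ∀ {φ} → Cong φ → ∀ {x y} → x ≈ y → eval x φ R.≈ eval y φ
    eval-≈ {φ} φ-cong {x} {y} x≈y = begin
      eval x φ                           ≈⟨ eval-Σ L φ-cong L! x (AllP.++⁻ˡ gx all∈) ⟩
      Σ-list L (λ h → coeff x h R.* φ h) ≈⟨ Σ-cong L (λ h → R.*-congʳ (x≈y h)) ⟩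
      Σ-list L (λ h → coeff y h R.* φ h) ≈⟨ eval-Σ L φ-cong L! y (AllP.++⁻ʳ gx all∈) ⟨
      eval y φ                           ∎
      where
      gx = List.map proj₂ x
      gs = gx ++ List.map proj₂ y
      L  = deduplicate _≟_ gs
      L! : Unique L
      L! = DecSetoidUnique.deduplicate-! decSetoid gs
      self : ∀ xs → All (_∈ xs) xs
      self []       = []
      self (g ∷ xs) = here G.refl ∷ All.map there (self xs)
      all∈ : All (_∈ L) gs
      all∈ = All.map (SetoidMembershipProperties.∈-deduplicate⁺ G.setoid _≟_
        (λ p q → G.trans q (G.sym p))) (self gs)

    ≈-eval : ∀ {x y} → (∀ {φ} → Cong φ → eval x φ R.≈ eval y φ) → x ≈ y
    ≈-eval {x} {y} e h = R.trans (coeff-eval x h) (R.trans (e (δ-cong h)) (R.sym (coeff-eval y h)))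

    eval-+ : ∀ x y φ → eval (x + y) φ R.≈ eval x φ R.+ eval y φ
    eval-+ []            y φ = R.sym (R.+-identityˡ _)
    eval-+ ((r , g) ∷ x) y φ = R.trans (R.+-congˡ (eval-+ x y φ)) (R.sym (R.+-assoc _ _ _))

    eval-neg : ∀ x φ → eval (- x) φ R.≈ R.- eval x φ
    eval-neg []            φ = R.sym RP.-0#≈0#
    eval-neg ((r , g) ∷ x) φ = R.trans
      (R.+-cong (R.sym (RP.-‿distribˡ-* r (φ g))) (eval-neg x φ)) (AG.⁻¹-∙-comm _ _)

    eval-scale : ∀ r g y φ →
      eval (List.map (λ (s , h) → r R.* s , g G.∙ h) y) φ R.≈ r R.* eval y (λ h → φ (g G.∙ h))
    eval-scale r g []            φ = R.sym (R.zeroʳ r)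
    eval-scale r g ((s , h) ∷ y) φ = R.trans
      (R.+-cong (R.*-assoc _ _ _) (eval-scale r g y φ)) (R.sym (R.distribˡ r _ _))

    eval-* : ∀ x y φ → eval (x * y) φ R.≈ eval x (λ g → eval y (λ h → φ (g G.∙ h)))
    eval-* []            y φ = R.refl
    eval-* ((r , g) ∷ x) y φ = R.trans
      (eval-+ (List.map (λ (s , h) → r R.* s , g G.∙ h) y) (x * y) φ)
      (R.+-cong (eval-scale r g y φ) (eval-* x y φ))

    eval-fun-+ : ∀ x φ ψ → eval x (λ g → φ g R.+ ψ g) R.≈ eval x φ R.+ eval x ψ
    eval-fun-+ []            φ ψ = R.sym (R.+-identityˡ _)
    eval-fun-+ ((r , g) ∷ x) φ ψ = R.trans
      (R.+-cong (R.distribˡ _ _ _) (eval-fun-+ x φ ψ)) (CS.interchange _ _ _ _)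

    shiftˡ : ∀ {φ} → Cong φ → ∀ g → Cong (λ h → φ (g G.∙ h))
    shiftˡ φ-cong g e = φ-cong (G.∙-congˡ e)

    shiftʳ : ∀ {φ} → Cong φ → ∀ y → Cong (λ g → eval y (λ h → φ (g G.∙ h)))
    shiftʳ φ-cong y e = eval-cong y (λ h → φ-cong (G.∙-congʳ e))

  isRing : IsRing _≈_ _+_ _*_ -_ 0# 1#
  isRing = record
    { +-isAbelianGroup = record
      { isGroup = record
        { isMonoid = record
          { isSemigroup = record
            { isMagma = record
              { isEquivalence = record
                { refl  = λ _ → R.refl
                ; sym   = λ e h → R.sym (e h)
                ; trans = λ e f h → R.trans (e h) (f h)
                }
              ; ∙-cong = λ {x} {y} {u} {v} x≈y u≈v → ≈-eval {x + u} {y + v} λ {φ} φ-cong → begin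
                  eval (x + u) φ            ≈⟨ eval-+ x u φ ⟩
                  eval x φ R.+ eval u φ     ≈⟨ R.+-cong (eval-≈ φ-cong {x} {y} x≈y) (eval-≈ φ-cong {u} {v} u≈v) ⟩
                  eval y φ R.+ eval v φ     ≈⟨ eval-+ y v φ ⟨
                  eval (y + v) φ            ∎
              }
            ; assoc = λ x y z → ≈-eval {x + y + z} {x + (y + z)} λ {φ} _ → begin
                eval (x + y + z) φ                      ≈⟨ eval-+ (x + y) z φ ⟩
                eval (x + y) φ R.+ eval z φ             ≈⟨ R.+-congʳ (eval-+ x y φ) ⟩
                eval x φ R.+ eval y φ R.+ eval z φ      ≈⟨ R.+-assoc _ _ _ ⟩
                eval x φ R.+ (eval y φ R.+ eval z φ)    ≈⟨ R.+-congˡ (eval-+ y z φ) ⟨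
                eval x φ R.+ eval (y + z) φ             ≈⟨ eval-+ x (y + z) φ ⟨
                eval (x + (y + z)) φ                    ∎
            }
          ; identity = (λ _ _ → R.refl) , λ x → ≈-eval {x + 0#} {x} λ {φ} _ →
              R.trans (eval-+ x 0# φ) (R.+-identityʳ _)
          }
        ; inverse =
            (λ x → ≈-eval {(- x) + x} {0#} λ {φ} _ → R.trans (eval-+ (- x) x φ)
              (R.trans (R.+-congʳ (eval-neg x φ)) (R.-‿inverseˡ _)))
          , (λ x → ≈-eval {x + (- x)} {0#} λ {φ} _ → R.trans (eval-+ x (- x) φ)
              (R.trans (R.+-congˡ (eval-neg x φ)) (R.-‿inverseʳ _)))
        ; ⁻¹-cong = λ {x} {y} x≈y → ≈-eval {(- x)} {(- y)} λ {φ} φ-cong → R.trans (eval-neg x φ)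
            (R.trans (R.-‿cong (eval-≈ φ-cong {x} {y} x≈y)) (R.sym (eval-neg y φ)))
        }
      ; comm = λ x y → ≈-eval {x + y} {y + x} λ {φ} _ → R.trans (eval-+ x y φ)
          (R.trans (R.+-comm _ _) (R.sym (eval-+ y x φ)))
      }
    ; *-cong = λ {x} {y} {u} {v} x≈y u≈v → ≈-eval {x * u} {y * v} λ {φ} φ-cong → begin
        eval (x * u) φ                          ≈⟨ eval-* x u φ ⟩
        eval x (λ g → eval u (λ h → φ (g G.∙ h)))
          ≈⟨ eval-cong x (λ g → eval-≈ (shiftˡ φ-cong g) {u} {v} u≈v) ⟩
        eval x (λ g → eval v (λ h → φ (g G.∙ h)))
          ≈⟨ eval-≈ (shiftʳ φ-cong v) {x} {y} x≈y ⟩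
        eval y (λ g → eval v (λ h → φ (g G.∙ h)))  ≈⟨ eval-* y v φ ⟨
        eval (y * v) φ                          ∎
    ; *-assoc = λ x y z → ≈-eval {x * y * z} {x * (y * z)} λ {φ} φ-cong → begin
        eval (x * y * z) φ                      ≈⟨ eval-* (x * y) z φ ⟩
        eval (x * y) (λ g → eval z (λ k → φ (g G.∙ k)))
          ≈⟨ eval-* x y _ ⟩
        eval x (λ g → eval y (λ h → eval z (λ k → φ ((g G.∙ h) G.∙ k))))
          ≈⟨ eval-cong x (λ g → eval-cong y λ h → eval-cong z λ k → φ-cong (G.assoc g h k)) ⟩
        eval x (λ g → eval y (λ h → eval z (λ k → φ (g G.∙ (h G.∙ k)))))
          ≈⟨ eval-cong x (λ g → eval-* y z (λ h → φ (g G.∙ h))) ⟨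
        eval x (λ g → eval (y * z) (λ h → φ (g G.∙ h)))
          ≈⟨ eval-* x (y * z) φ ⟨
        eval (x * (y * z)) φ                    ∎
    ; *-identity =
        (λ x → ≈-eval {1# * x} {x} λ {φ} φ-cong → begin
          eval (1# * x) φ                                       ≈⟨ eval-* 1# x φ ⟩
          R.1# R.* eval x (λ h → φ (G.ε G.∙ h)) R.+ R.0#        ≈⟨ R.+-identityʳ _ ⟩
          R.1# R.* eval x (λ h → φ (G.ε G.∙ h))                 ≈⟨ R.*-identityˡ _ ⟩
          eval x (λ h → φ (G.ε G.∙ h))                          ≈⟨ eval-cong x (λ h → φ-cong (G.identityˡ h)) ⟩
          eval x φ                                              ∎)
      , (λ x → ≈-eval {x * 1#} {x} λ {φ} φ-cong → begin
          eval (x * 1#) φ                                       ≈⟨ eval-* x 1# φ ⟩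
          eval x (λ g → R.1# R.* φ (g G.∙ G.ε) R.+ R.0#)
            ≈⟨ eval-cong x (λ g → R.trans (R.+-identityʳ _) (R.trans (R.*-identityˡ _) (φ-cong (G.identityʳ g)))) ⟩
          eval x φ                                              ∎)
    ; distrib =
        (λ x y z → ≈-eval {x * (y + z)} {x * y + x * z} λ {φ} _ → begin
          eval (x * (y + z)) φ                                  ≈⟨ eval-* x (y + z) φ ⟩
          eval x (λ g → eval (y + z) (λ h → φ (g G.∙ h)))       ≈⟨ eval-cong x (λ g → eval-+ y z _) ⟩
          eval x (λ g → eval y (λ h → φ (g G.∙ h)) R.+ eval z (λ h → φ (g G.∙ h)))
            ≈⟨ eval-fun-+ x _ _ ⟩
          eval x (λ g → eval y (λ h → φ (g G.∙ h))) R.+ eval x (λ g → eval z (λ h → φ (g G.∙ h)))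
            ≈⟨ R.+-cong (eval-* x y φ) (eval-* x z φ) ⟨
          eval (x * y) φ R.+ eval (x * z) φ                     ≈⟨ eval-+ (x * y) (x * z) φ ⟨
          eval (x * y + x * z) φ                                ∎)
      , (λ x y z → ≈-eval {(y + z) * x} {y * x + z * x} λ {φ} _ → begin
          eval ((y + z) * x) φ                                  ≈⟨ eval-* (y + z) x φ ⟩
          eval (y + z) (λ g → eval x (λ h → φ (g G.∙ h)))       ≈⟨ eval-+ y z _ ⟩
          eval y (λ g → eval x (λ h → φ (g G.∙ h))) R.+ eval z (λ g → eval x (λ h → φ (g G.∙ h)))
            ≈⟨ R.+-cong (eval-* y x φ) (eval-* z x φ) ⟨
          eval (y * x) φ R.+ eval (z * x) φ                     ≈⟨ eval-+ (y * x) (z * x) φ ⟨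
          eval (y * x + z * x) φ                                ∎)
    }

  ring : Ring (c ⊔ c′) (ℓ ⊔ c′)
  ring = record { isRing = isRing }

-- The left R-module ⟨m | lhsᵢ m = rhsᵢ m⟩: the free module R m, where x stands
-- for x m, modulo the least module congruence containing the relations.
module CyclicModule {c ℓ i} (R : Ring c ℓ) {I : Set i} (lhs rhs : I → Ring.Carrier R) where

  open Ring R
  private module RP = RingProperties R

  infix 4 _≈ᴹ_
  data _≈ᴹ_ : Rel Carrier (c ⊔ ℓ ⊔ i) where
    relation : ∀ i → lhs i ≈ᴹ rhs i
    ≈⇒≈ᴹ     : ∀ {x y} → x ≈ y → x ≈ᴹ y
    symᴹ     : ∀ {x y} → x ≈ᴹ y → y ≈ᴹ x
    transᴹ   : ∀ {x y z} → x ≈ᴹ y → y ≈ᴹ z → x ≈ᴹ z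
    +-congᴹ  : ∀ {x y u v} → x ≈ᴹ y → u ≈ᴹ v → x + u ≈ᴹ y + v
    *-congᴹ  : ∀ r {x y} → x ≈ᴹ y → r * x ≈ᴹ r * y

  leftModule : LeftModule R c (c ⊔ ℓ ⊔ i)
  leftModule = record
    { Carrierᴹ = Carrier
    ; _≈ᴹ_ = _≈ᴹ_
    ; _+ᴹ_ = _+_
    ; _*ₗ_ = _*_
    ; 0ᴹ = 0#
    ; -ᴹ_ = -_
    ; isLeftModule = record
      { isLeftSemimodule = record
        { +ᴹ-isCommutativeMonoid = record
          { isMonoid = record
            { isSemigroup = record
              { isMagma = record
                { isEquivalence = record { refl = ≈⇒≈ᴹ refl ; sym = symᴹ ; trans = transᴹ }
                ; ∙-cong = +-congᴹ
                }
              ; assoc = λ x y z → ≈⇒≈ᴹ (+-assoc x y z)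
              }
            ; identity = (λ x → ≈⇒≈ᴹ (+-identityˡ x)) , (λ x → ≈⇒≈ᴹ (+-identityʳ x))
            }
          ; comm = λ x y → ≈⇒≈ᴹ (+-comm x y)
          }
        ; isPreleftSemimodule = record
          { *ₗ-cong = λ {r} {s} r≈s x≈y → transᴹ (*-congᴹ r x≈y) (≈⇒≈ᴹ (*-congʳ r≈s))
          ; *ₗ-zeroˡ = λ x → ≈⇒≈ᴹ (zeroˡ x)
          ; *ₗ-distribʳ = λ x r s → ≈⇒≈ᴹ (distribʳ x r s)
          ; *ₗ-identityˡ = λ x → ≈⇒≈ᴹ (*-identityˡ x)
          ; *ₗ-assoc = λ r s x → ≈⇒≈ᴹ (*-assoc r s x)
          ; *ₗ-zeroʳ = λ r → ≈⇒≈ᴹ (zeroʳ r)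
          ; *ₗ-distribˡ = λ r x y → ≈⇒≈ᴹ (distribˡ r x y)
          }
        }
      ; -ᴹ‿cong = λ {x} {y} x≈y → transᴹ (≈⇒≈ᴹ (sym (RP.-1*x≈-x x)))
          (transᴹ (*-congᴹ (- 1#) x≈y) (≈⇒≈ᴹ (RP.-1*x≈-x y)))
      ; -ᴹ‿inverse = (λ x → ≈⇒≈ᴹ (-‿inverseˡ x)) , (λ x → ≈⇒≈ᴹ (-‿inverseʳ x))
      }
    }

  generator : Carrier
  generator = 1#

-- στ means: apply τ first, so it is the library's τ ∘ₚ σ.
symmetricGroup : ℕ → Group 0ℓ 0ℓ
symmetricGroup k = record
  { Carrier = Permutation′ k
  ; _≈_ = Perm._≈_
  ; _∙_ = λ σ τ → τ ∘ₚ σ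
  ; ε = Perm.id
  ; _⁻¹ = flip
  ; isGroup = record
    { isMonoid = record
      { isSemigroup = record
        { isMagma = record
          { isEquivalence = record
            { refl  = λ _ → ≡.refl
            ; sym   = λ e i → ≡.sym (e i)
            ; trans = λ e f i → ≡.trans (e i) (f i)
            }
          ; ∙-cong = λ {σ} {σ′} {τ} {τ′} e f i → ≡.trans (≡.cong (σ ⟨$⟩ʳ_) (f i)) (e (τ′ ⟨$⟩ʳ i))
          }
        ; assoc = λ _ _ _ _ → ≡.refl
        }
      ; identity = (λ _ _ → ≡.refl) , (λ _ _ → ≡.refl)
      }
    ; inverse = (λ σ _ → Perm.inverseˡ σ) , (λ σ _ → Perm.inverseʳ σ)
    ; ⁻¹-cong = λ {σ} {τ} e i → ≡.trans
        (≡.cong (σ Perm.⟨$⟩ˡ_) (≡.trans (≡.sym (Perm.inverseʳ τ)) (≡.sym (e (τ Perm.⟨$⟩ˡ i)))))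
        (Perm.inverseˡ σ)
    }
  }

_≟ₚ_ : ∀ {k} → Decidable (Group._≈_ (symmetricGroup k))
σ ≟ₚ τ = Fin.all? λ i → (σ ⟨$⟩ʳ i) Fin.≟ (τ ⟨$⟩ʳ i)

-- tᵢ = (i i+1) for 1 ≤ i < k.  The points 1, …, k are the elements 0, …, k-1 of
-- Fin k.  The value at other i is junk and is never used.
coxeter : ∀ k → ℕ → Permutation′ k
coxeter k ℕ.zero    = Perm.id
coxeter k (ℕ.suc j) with ℕ.suc j ℕ.<? k
... | yes j+1<k = Perm.transpose (fromℕ< (ℕ.<-trans (ℕ.n<1+n j) j+1<k)) (fromℕ< j+1<k)
... | no _      = Perm.id

-- The integers from a to b, in increasing order; empty if b < a.
[_⋯_] : ℕ → ℕ → List ℕ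
[ a ⋯ b ] = List.applyUpTo (a ℕ.+_) (ℕ.suc b ℕ.∸ a)

module PermutationModule {c ℓ} (𝔽 : Field c ℓ) (f g : ℕ) where

  private module 𝔽 = Field 𝔽

  k : ℕ
  k = f ℕ.+ g

  open GroupAlgebra 𝔽.commutativeRing (symmetricGroup k) _≟ₚ_ public
    using (single) renaming (ring to 𝔽𝔖ₖ)
  open Ring 𝔽𝔖ₖ using (Carrier; _*_; _-_; 1#)

  t : ℕ → Carrier
  t i = single 𝔽.1# (coxeter k i)

  s : ℕ → Carrier
  s i = t i - 1#

  RelationIndex : Set
  RelationIndex = ∃[ i ] 1 ℕ.≤ i × i ℕ.< k × ¬ i ≡ f

  module Presentation = CyclicModule 𝔽𝔖ₖ {RelationIndex} (λ (i , _) → t i) (λ _ → 1#)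

  M : LeftModule 𝔽𝔖ₖ c (c ⊔ ℓ)
  M = Presentation.leftModule

  open LeftModule M public using (Carrierᴹ; _≈ᴹ_; _+ᴹ_; 0ᴹ; _*ₗ_)

  m : Carrierᴹ
  m = Presentation.generator

  infixr 7 _·_
  _·_ : 𝔽.Carrier → Carrierᴹ → Carrierᴹ
  a · x = single a Perm.id *ₗ x

  ∏ : List Carrier → Carrier
  ∏ = foldr _*_ 1#

  -- x_{λᵣ+g-r+1} ⋯ x_{f+g-r}; here r : Fin g counts from 0, so the r of this
  -- formula is suc (toℕ r).
  factor : (ℕ → Carrier) → Vec ℕ g → Fin g → Carrier
  factor x ν r =
    let g-r = g ℕ.∸ ℕ.suc (toℕ r)
    in ∏ (List.map x [ lookup ν r ℕ.+ g-r ℕ.+ 1 ⋯ f ℕ.+ g-r ])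

  monomial : (ℕ → Carrier) → Vec ℕ g → Carrier
  monomial x ν = ∏ (List.map (factor x ν) (List.allFin g))

  t[_] : Vec ℕ g → Carrier
  t[ ν ] = monomial t ν

  s[_] : Vec ℕ g → Carrier
  s[ ν ] = monomial s ν

  open SemiringMult 𝔽.semiring using () renaming (_×_ to _×′_)

  F𝔽 : Vec ℕ g → 𝔽.Carrier
  F𝔽 ν = Partitions.F (toList ν) ×′ 𝔽.1#

  ∑ : List (Vec ℕ g) → (Vec ℕ g → Carrierᴹ) → Carrierᴹ
  ∑ νs φ = foldr _+ᴹ_ 0ᴹ (List.map φ νs)

{-# OPTIONS --safe #-}
module Submission where

-- Encode λ by its boundary path, a word in the letters col and row, and read
-- col as an opening and row as a closing bracket.  Then s_λ m is the
-- alternating sum of words in which every matched pair col⋯row is replaced by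
-- col⋯row minus row⋯col, and F(λ) counts the linear extensions of the forest of
-- brackets, where an unmatched row encloses everything to its left and an
-- unmatched col everything to its right.  Removing the first element of a
-- linear extension removes a leaf: an initial row, a final col or a factor
-- col row.  Applied to all λ at once this turns the right-hand side into
-- shorter instances of itself, and by induction it becomes a telescoping sum
-- that adds up to the sum of all words, which is the left-hand side.

open import Defs
open import Algebra.Bundles using (AbelianGroup; CommutativeRing; Group; Ring)
open import Algebra.Module.Bundles using (LeftModule)
import Algebra.Properties.AbelianGroup as AbelianGroupProperties
import Algebra.Properties.CommutativeMonoid.Mult as Mult
import Algebra.Properties.CommutativeSemigroup as CommutativeSemigroupProperties
import Algebra.Properties.Semiring.Mult as SemiringMult
import Algebra.Solver.CommutativeMonoid as CommutativeMonoidSolver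
open import Data.Empty using (⊥-elim)
open import Data.Fin.Base using (Fin; toℕ)
open import Data.Fin.Permutation as Perm using (Permutation′; _⟨$⟩ʳ_; _⟨$⟩ˡ_)
import Data.Fin.Permutation.Components as PC
import Data.Fin.Properties as Fin
open import Data.List.Base using (List; []; _∷_; _++_; _∷ʳ_; map; foldr; concatMap; applyUpTo; upTo; tabulate; allFin; length; replicate)
open import Data.List.Properties using (++-assoc; ++-identityʳ; length-++; concatMap-++; upTo-∷ʳ; map-tabulate)
open import Data.List.Relation.Unary.All as All using (All; []; _∷_)
import Data.List.Relation.Unary.All.Properties as All
open import Data.Nat using (ℕ)
open import Data.Nat.Base as ℕ using (zero; suc; _≤_; _<_; z≤n; s≤s; s≤s⁻¹; _∸_)
import Data.Nat.Properties as ℕ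
open import Data.Product.Base using (_×_; _,_)
open import Data.Sum.Base using (_⊎_; inj₁; inj₂)
open import Data.Vec.Base using (Vec; []; _∷_; toList; lookup)
open import Function.Base using (_∘_; id)
open import Level using (_⊔_)
open import Relation.Binary.Definitions using (Decidable)
import Relation.Binary.Reasoning.Setoid as SetoidReasoning
open import Relation.Binary.PropositionalEquality as ≡ using (_≡_; _≢_)
open import Relation.Nullary using (¬_; Dec; yes; no)
open import Relation.Nullary.Decidable using (_×-dec_; dec-true; dec-false)
open Partitions using (𝒫; F)

-- Removing a leaf changes the shape: an initial row lowers g, a final col lowers f, a factor col
-- row lowers both. No single box survives the induction, so the identity is proved for all words of
-- a given length at once and for an arbitrary function from words to an abelian group. The module
-- enters through one such function only: t_μ m on the words of the box, zero on all other words.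
-- The recursion for F cuts the diagram at a node with a + b maximal. In terms of brackets this is a
-- cut between the unmatched rows and the unmatched cols, and the binomial coefficient counts the
-- interleavings of linear extensions of the two sides. Each factor s_i that turns row col into col
-- row re-pairs the brackets as in Temperley-Lieb diagrams: the two adjacent letters become a pair
-- and their former partners are joined. This rests on t_i - 1 killing words with equal letters in
-- the two places, so the action of t_i on every t_μ m has to be known, including those that it
-- fixes.

module Words where

  open Partitions using (F-∅; F-step; Node; here; there; IsEmpty; MaxNode; _,_; chooseNode; measure; below-<; rightOf-<)
  open import Data.List.Base using (drop)
  open import Data.List.Properties using (map-++; map-replicate)
  open import Data.Nat.Base using (_+_; _*_; pred)
  open import Data.Nat.Combinatorics using (_C_; nCn≡1; nCk≡nC[n∸k]; nCk+nC[k+1]≡[n+1]C[k+1])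
  open import Data.Nat.Induction using (<-wellFounded)
  open import Data.Nat.Properties
  open import Data.Nat.Tactic.RingSolver using (solve-∀)
  open import Data.Product.Base using (∃; ∃₂)
  open import Induction.WellFounded using (Acc; acc)
  open import Relation.Binary.PropositionalEquality

  -- Trailing zeros in the recursion for `F`

  node-++⁺ : ∀ {ν ζ a b} → Node ν a b → Node (ν ++ ζ) a b
  node-++⁺ (here p q) = here p q
  node-++⁺ (there n)  = there (node-++⁺ n)

  node-zeros⁻ : ∀ ν r {a b} → Node (ν ++ replicate r 0) a b → Node ν a b
  node-zeros⁻ []      (suc r) (here (s≤s _) ())
  node-zeros⁻ []      (suc r) (there n) with () ← node-zeros⁻ [] r n
  node-zeros⁻ (x ∷ ν) r       (here p q) = here p q
  node-zeros⁻ (x ∷ ν) r       (there n)  = there (node-zeros⁻ ν r n)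

  drop-++-node : ∀ {ν ζ a b} → Node ν a b → drop a (ν ++ ζ) ≡ drop a ν ++ ζ
  drop-++-node (here _ _) = refl
  drop-++-node (there n)  = drop-++-node n

  map-∸-zeros : ∀ b r → map (_∸ b) (replicate r 0) ≡ replicate r 0
  map-∸-zeros b r = trans (map-replicate (_∸ b) r 0) (cong (replicate r) (0∸n≡0 b))

  -- `parts` writes 0 for a row with no col to its right, and subtracting columns creates more such
  -- parts. Zeros add no nodes, so the same maximal node serves both lists throughout the recursion.
  F-zeros : ∀ ν r → F (ν ++ replicate r 0) ≡ F ν
  F-zeros ν r = go ν (<-wellFounded (measure ν)) (chooseNode ν)
    where
    go : ∀ ν → Acc _<_ (measure ν) → IsEmpty ν ⊎ ∃₂ (MaxNode ν) → F (ν ++ replicate r 0) ≡ F ν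
    go ν _ (inj₁ e) = trans (F-∅ {ν ++ replicate r 0} λ n → e (node-zeros⁻ ν r n)) (sym (F-∅ {ν} e))
    go ν (acc rec) (inj₂ (a , b , n , max)) = begin
      F (ν ++ ζ)
        ≡⟨ F-step (ν ++ ζ) (node-++⁺ n , λ n′ → max (node-zeros⁻ ν r n′)) ⟩
      ((a + b) C a) * F (drop a (ν ++ ζ)) * F (map (_∸ b) (ν ++ ζ))
        ≡⟨ cong₂ (λ x y → ((a + b) C a) * F x * F y) (drop-++-node n)
             (trans (map-++ (_∸ b) ν ζ) (cong (map (_∸ b) ν ++_) (map-∸-zeros b r))) ⟩
      ((a + b) C a) * F (drop a ν ++ ζ) * F (map (_∸ b) ν ++ ζ)
        ≡⟨ cong₂ (λ x y → ((a + b) C a) * x * y)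
             (go (drop a ν) (rec (below-< n)) (chooseNode _)) (go (map (_∸ b) ν) (rec (rightOf-< n)) (chooseNode _)) ⟩
      ((a + b) C a) * F (drop a ν) * F (map (_∸ b) ν)
        ≡⟨ F-step ν (n , max) ⟨
      F ν ∎
      where
      open ≡-Reasoning
      ζ = replicate r 0

  -- Words, bracket matching and the cut at a maximal node

  data Step : Set where
    col row : Step

  Word : Set
  Word = List Step

  cols rows : Word → ℕ
  cols []        = 0
  cols (col ∷ w) = suc (cols w)
  cols (row ∷ w) = cols w
  rows []        = 0
  rows (col ∷ w) = rows w
  rows (row ∷ w) = suc (rows w)

  parts : Word → List ℕ
  parts []        = []
  parts (col ∷ w) = parts w
  parts (row ∷ w) = cols w ∷ parts w

  weight : Word → ℕ
  weight w = F (parts w)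

  weight-[] : weight [] ≡ 1
  weight-[] = refl

  cols-++ : ∀ u v → cols (u ++ v) ≡ cols u + cols v
  cols-++ []        v = refl
  cols-++ (col ∷ u) v = cong suc (cols-++ u v)
  cols-++ (row ∷ u) v = cols-++ u v

  parts-∷ʳ : ∀ w → parts (w ∷ʳ row) ≡ parts w ++ replicate 1 0
  parts-∷ʳ []        = refl
  parts-∷ʳ (col ∷ w) = parts-∷ʳ w
  parts-∷ʳ (row ∷ w) = cong₂ _∷_ (trans (cols-++ w _) (+-identityʳ _)) (parts-∷ʳ w)

  weight-∷ʳ : ∀ w → weight (w ∷ʳ row) ≡ weight w
  weight-∷ʳ w = trans (cong F (parts-∷ʳ w)) (F-zeros (parts w) 1)

  -- Read col as an opening and row as a closing bracket.  Closed d w: after d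
  -- unclosed brackets, w leaves no bracket unclosed.  Opening d w: after d
  -- unclosed brackets, every closing bracket of w has a partner.
  data Closed : ℕ → Word → Set where
    []  : Closed 0 []
    col : ∀ {d w} → Closed (suc d) w → Closed d (col ∷ w)
    row : ∀ {d w} → Closed (pred d) w → Closed d (row ∷ w)

  data Opening : ℕ → Word → Set where
    []  : ∀ {d} → Opening d []
    col : ∀ {d w} → Opening (suc d) w → Opening d (col ∷ w)
    row : ∀ {d w} → Opening d w → Opening (suc d) (row ∷ w)

  opening-suc : ∀ {d w} → Opening d w → Opening (suc d) w
  opening-suc []      = []
  opening-suc (col o) = col (opening-suc o)
  opening-suc (row o) = row (opening-suc o)

  -- An additional open bracket in front of `u` is closed by the first row of `u` that lacks a
  -- partner; if there is none, every row of `u` was already matched.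
  closed-suc : ∀ {d u v} → Closed d u → Opening 0 v → Closed (suc d) u ⊎ Opening d (u ++ v)
  closed-suc []      o = inj₂ o
  closed-suc (col c) o with closed-suc c o
  ... | inj₁ c′ = inj₁ (col c′)
  ... | inj₂ o′ = inj₂ (col o′)
  closed-suc {zero}  (row c) o = inj₁ (row c)
  closed-suc {suc d} (row c) o with closed-suc c o
  ... | inj₁ c′ = inj₁ (row c′)
  ... | inj₂ o′ = inj₂ (row o′)

  -- The cut lies after every unmatched row and before every unmatched col. There the number of rows
  -- to the left plus the number of cols to the right is largest, so if both halves are nonempty the
  -- cut marks a node with a + b maximal.
  split : ∀ w → ∃₂ λ u v → w ≡ u ++ v × Closed 0 u × Opening 0 v
  split [] = [] , [] , refl , [] , []
  split (row ∷ w) with u , v , refl , c , o ← split w = row ∷ u , v , refl , row c , o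
  split (col ∷ w) with split w
  ... | u , v , refl , c , o with closed-suc c o
  ...   | inj₁ c′ = col ∷ u , v , refl , col c′ , o
  ...   | inj₂ o′ = [] , col ∷ u ++ v , refl , [] , col (opening-suc o′)

  closed-cols≤rows : ∀ {d u} → Closed d u → d + cols u ≤ rows u
  closed-cols≤rows [] = z≤n
  closed-cols≤rows {d} {col ∷ u} (col c) = subst (_≤ rows u) (sym (+-suc d (cols u))) (closed-cols≤rows c)
  closed-cols≤rows {zero}  (row c) = m≤n⇒m≤1+n (closed-cols≤rows c)
  closed-cols≤rows {suc d} (row c) = s≤s (closed-cols≤rows c)

  node-split : ∀ u {v} → 1 ≤ rows u → 1 ≤ cols v → Node (parts (u ++ v)) (rows u) (cols v)
  node-split (col ∷ u) p q = node-split u p q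
  node-split (row ∷ u) {v} p q with rows u in eq
  ... | zero  = here q (subst (cols v ≤_) (sym (cols-++ u v)) (m≤n+m _ _))
  ... | suc r = there (subst (λ r → Node (parts (u ++ v)) r (cols v)) eq
    (node-split u (subst (1 ≤_) (sym eq) (s≤s z≤n)) q))

  opening-node-≤ : ∀ {e v c d} → Opening e v → Node (parts v) c d → c + d ≤ e + cols v
  opening-node-≤ {e} {col ∷ v} {c} {d} (col o) n = subst (c + d ≤_) (sym (+-suc e (cols v))) (opening-node-≤ o n)
  opening-node-≤ {suc e} (row o) (here _ p) = s≤s (≤-trans p (m≤n+m _ e))
  opening-node-≤ (row o) (there n) = s≤s (opening-node-≤ o n)

  -- At the end of a row, c + e counts the rows up to it and the cols after it. Between such a
  -- corner in `u` and the cut there are at least as many rows as cols, by `closed-cols≤rows`;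
  -- between the cut and a corner in `v` there are at least as many cols as rows.
  node-split-max : ∀ {d u v c e} → Closed d u → Opening 0 v → Node (parts (u ++ v)) c e → c + e ≤ rows u + cols v
  node-split-max []      o n = opening-node-≤ o n
  node-split-max (col c) o n = node-split-max c o n
  node-split-max {d} {row ∷ u} {v} (row c) o (here _ p) = s≤s (≤-trans p
    (subst (_≤ rows u + cols v) (sym (cols-++ u v)) (+-monoˡ-≤ (cols v) (≤-trans (m≤n+m _ (pred d)) (closed-cols≤rows c)))))
  node-split-max (row c) o (there n) = s≤s (node-split-max c o n)

  drop-parts : ∀ u v → drop (rows u) (parts (u ++ v)) ≡ parts v
  drop-parts []        v = refl
  drop-parts (col ∷ u) v = drop-parts u v
  drop-parts (row ∷ u) v = drop-parts u v

  map-∸-parts : ∀ u v → map (_∸ cols v) (parts (u ++ v)) ≡ parts u ++ replicate (rows v) 0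
  map-∸-parts [] v = go v ≤-refl
    where
    go : ∀ {n} w → cols w ≤ n → map (_∸ n) (parts w) ≡ replicate (rows w) 0
    go []        p = refl
    go (col ∷ w) p = go w (<⇒≤ p)
    go (row ∷ w) p = cong₂ _∷_ (m≤n⇒m∸n≡0 p) (go w p)
  map-∸-parts (col ∷ u) v = map-∸-parts u v
  map-∸-parts (row ∷ u) v = cong₂ _∷_
    (trans (cong (_∸ cols v) (cols-++ u v)) (m+n∸n≡m (cols u) (cols v))) (map-∸-parts u v)

  closed-rows : ∀ {d x u} → Closed d (x ∷ u) → 1 ≤ rows (x ∷ u)
  closed-rows {d} {col} {u} (col c) = ≤-trans (s≤s z≤n) (closed-cols≤rows c)
  closed-rows {x = row} (row c) = s≤s z≤n

  -- The two halves are independent pieces of the forest. Each element of `u` contains exactly one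
  -- row and each element of `v` exactly one col, which explains the binomial coefficient. If a half
  -- is empty there is no node at the cut, hence the separate cases.
  weight-++ : ∀ {u v} → Closed 0 u → Opening 0 v →
    weight (u ++ v) ≡ ((rows u + cols v) C rows u) * weight v * weight u
  weight-++ {[]} {v} c o = sym (begin
    (cols v C 0) * weight v * weight []  ≡⟨ cong₂ (λ x y → x * weight v * y) (trans (nCk≡nC[n∸k] {n = cols v} z≤n) (nCn≡1 (cols v))) weight-[] ⟩
    1 * weight v * 1                     ≡⟨ trans (*-identityʳ _) (*-identityˡ _) ⟩
    weight v                             ∎)
    where open ≡-Reasoning
  weight-++ {u@(_ ∷ _)} {[]} c o = begin
    weight (u ++ [])                                    ≡⟨ cong weight (++-identityʳ u) ⟩
    weight u                                            ≡⟨ *-identityˡ _ ⟨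
    1 * 1 * weight u                                    ≡⟨ cong₂ (λ x y → x * y * weight u)
      (trans (cong (_C rows u) (+-identityʳ _)) (nCn≡1 (rows u))) weight-[] ⟨
    ((rows u + 0) C rows u) * weight [] * weight u      ∎
    where open ≡-Reasoning
  weight-++ {u@(_ ∷ _)} {v@(_ ∷ _)} c o@(col _) = begin
    weight (u ++ v)
      ≡⟨ F-step (parts (u ++ v)) (node-split u (closed-rows c) (s≤s z≤n) , node-split-max c o) ⟩
    ((rows u + cols v) C rows u) * F (drop (rows u) (parts (u ++ v))) * F (map (_∸ cols v) (parts (u ++ v)))
      ≡⟨ cong₂ (λ x y → ((rows u + cols v) C rows u) * F x * y) (drop-parts u v)
           (trans (cong F (map-∸-parts u v)) (F-zeros (parts u) (rows v))) ⟩
    ((rows u + cols v) C rows u) * weight v * weight u ∎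
    where open ≡-Reasoning

  -- Leaves and the recursion for linear extensions

  -- A col is a leaf if it is followed by a row or by nothing, a row if it comes
  -- first; Φ is evaluated at the word that remains when the leaf is removed.
  first next inner leaves : Word → (Word → ℕ) → ℕ

  first []        Φ = 0
  first (col ∷ w) Φ = 0
  first (row ∷ w) Φ = Φ w

  next []        Φ = Φ []
  next (col ∷ w) Φ = 0
  next (row ∷ w) Φ = Φ w

  inner []        Φ = 0
  inner (col ∷ w) Φ = next w Φ + inner w (Φ ∘ (col ∷_))
  inner (row ∷ w) Φ = inner w (Φ ∘ (row ∷_))

  leaves w Φ = first w Φ + inner w Φ

  next-∷ : ∀ x w Φ → next (x ∷ w) Φ ≡ first (x ∷ w) Φ
  next-∷ col w Φ = refl
  next-∷ row w Φ = refl

  first-++ : ∀ x u v Φ → first ((x ∷ u) ++ v) Φ ≡ first (x ∷ u) (Φ ∘ (_++ v))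
  first-++ col u v Φ = refl
  first-++ row u v Φ = refl

  -- A nonempty closed word ends in row, so no factor col row straddles the cut and no final col of
  -- `u` loses its place.
  inner-++ : ∀ {d u} → Closed d u → ∀ v Φ → inner (u ++ v) Φ ≡ inner u (Φ ∘ (_++ v)) + inner v (Φ ∘ (u ++_))
  inner-++ [] v Φ = refl
  inner-++ {u = col ∷ x ∷ u} (col c) v Φ = trans
    (cong₂ _+_ (trans (next-∷ x (u ++ v) Φ) (trans (first-++ x u v Φ) (sym (next-∷ x u _)))) (inner-++ c v _))
    (sym (+-assoc (next (x ∷ u) (Φ ∘ (_++ v))) _ _))
  inner-++ (row c) v Φ = inner-++ c v _

  -- A final col of `w` becomes a factor col row, and removing either leaves the same word. Every
  -- other leaf leaves a word with a trailing row, which `Φ` ignores.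
  inner-∷ʳ : ∀ w Φ → (∀ u → Φ (u ∷ʳ row) ≡ Φ u) → inner (w ∷ʳ row) Φ ≡ inner w Φ
  inner-∷ʳ [] Φ e = refl
  inner-∷ʳ (col ∷ w) Φ e = cong₂ _+_ (go w) (inner-∷ʳ w _ (e ∘ (col ∷_)))
    where
    go : ∀ w → next (w ∷ʳ row) Φ ≡ next w Φ
    go []        = refl
    go (col ∷ w) = refl
    go (row ∷ w) = e w
  inner-∷ʳ (row ∷ w) Φ e = inner-∷ʳ w _ (e ∘ (row ∷_))

  leaves-∷ʳ : ∀ x w Φ → (∀ u → Φ (u ∷ʳ row) ≡ Φ u) → leaves ((x ∷ w) ∷ʳ row) Φ ≡ leaves (x ∷ w) Φ
  leaves-∷ʳ x w Φ e = cong₂ _+_ (go x) (inner-∷ʳ (x ∷ w) Φ e)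
    where
    go : ∀ x → first ((x ∷ w) ∷ʳ row) Φ ≡ first (x ∷ w) Φ
    go col = refl
    go row = e w

  -- A leaf removed from a closed word leaves a closed word with one row fewer, so the product
  -- formula `weight-++` can be applied to each term with the same binomial coefficient. For opening
  -- words the same holds with cols.
  inner-closed : ∀ {d u} K {Φ Ψ} → Closed d u →
    (∀ {u′} → Closed d u′ → suc (rows u′) ≡ rows u → Φ u′ ≡ K * Ψ u′) → inner u Φ ≡ K * inner u Ψ
  inner-closed K [] e = sym (*-zeroʳ K)
  inner-closed {d} {col ∷ u} K {Φ} {Ψ} (col c) e = trans
    (cong₂ _+_ (go c e) (inner-closed K c λ c′ → e (col c′)))
    (sym (*-distribˡ-+ K (next u Ψ) _))
    where
    go : ∀ {w} → Closed (suc d) w → (∀ {u′} → Closed d u′ → suc (rows u′) ≡ rows w → Φ u′ ≡ K * Ψ u′) →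
      next w Φ ≡ K * next w Ψ
    go (col _) e = sym (*-zeroʳ K)
    go (row c) e = e c refl
  inner-closed K (row c) e = inner-closed K c λ c′ eq → e (row c′) (cong suc eq)

  leaves-closed : ∀ {u} K {Φ Ψ} → Closed 0 u →
    (∀ {u′} → Closed 0 u′ → suc (rows u′) ≡ rows u → Φ u′ ≡ K * Ψ u′) → leaves u Φ ≡ K * leaves u Ψ
  leaves-closed {u} K {Φ} {Ψ} c e = trans
    (cong₂ _+_ (go c e) (inner-closed K c e)) (sym (*-distribˡ-+ K (first u Ψ) _))
    where
    go : ∀ {w} → Closed 0 w → (∀ {u′} → Closed 0 u′ → suc (rows u′) ≡ rows w → Φ u′ ≡ K * Ψ u′) →
      first w Φ ≡ K * first w Ψ
    go []      e = sym (*-zeroʳ K)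
    go (col _) e = sym (*-zeroʳ K)
    go (row c) e = e c refl

  inner-opening : ∀ {d v} K {Φ Ψ} → Opening d v →
    (∀ {v′} → Opening d v′ → suc (cols v′) ≡ cols v → Φ v′ ≡ K * Ψ v′) → inner v Φ ≡ K * inner v Ψ
  inner-opening K [] e = sym (*-zeroʳ K)
  inner-opening {d} {col ∷ v} K {Φ} {Ψ} (col o) e = trans
    (cong₂ _+_ (go o e) (inner-opening K o λ o′ eq → e (col o′) (cong suc eq)))
    (sym (*-distribˡ-+ K (next v Ψ) _))
    where
    go : ∀ {w} → Opening (suc d) w → (∀ {v′} → Opening d v′ → suc (cols v′) ≡ suc (cols w) → Φ v′ ≡ K * Ψ v′) →
      next w Φ ≡ K * next w Ψ
    go []      e = e [] refl
    go (col _) e = sym (*-zeroʳ K)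
    go (row o) e = e o refl
  inner-opening K (row o) e = inner-opening K o λ o′ → e (row o′)

  closed-snoc : ∀ {d x u} → Closed d (x ∷ u) → ∃ λ u′ → x ∷ u ≡ u′ ∷ʳ row
  closed-snoc {u = []} (row c) = [] , refl
  closed-snoc {u = []} (col ())
  closed-snoc {u = y ∷ u} (col c) with u′ , eq ← closed-snoc c = col ∷ u′ , cong (col ∷_) eq
  closed-snoc {u = y ∷ u} (row c) with u′ , eq ← closed-snoc c = row ∷ u′ , cong (row ∷_) eq

  C-pascal : ∀ {r} q → 1 ≤ r → ((pred r + suc q) C pred r) + ((r + q) C r) ≡ (r + suc q) C r
  C-pascal {suc p} q _ = trans (cong (λ n → ((p + suc q) C p) + (n C suc p)) (sym (+-suc p q)))
    (nCk+nC[k+1]≡[n+1]C[k+1] (p + suc q) p)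

  -- Closed and Opening words split at a maximal node, so removing a leaf from
  -- either half turns the recursion for F into Pascal's rule.
  weight-leaves : ∀ x w → weight (x ∷ w) ≡ leaves (x ∷ w) weight
  weight-leaves x w = go (x ∷ w) (<-wellFounded _) (s≤s z≤n)
    where
    open ≡-Reasoning
    go : ∀ w → Acc _<_ (length w) → 0 < length w → weight w ≡ leaves w weight
    go w _ _ with split w
    go _ _ () | [] , [] , refl , _ , _
    go _ (acc rec) _ | [] , col ∷ [] , refl , _ , _ = sym (+-identityʳ _)
    -- Dropping the leading col changes no part. An initial row of `v` is a leaf either way: as a
    -- first letter of `v`, or in a factor col row of the whole word.
    go _ (acc rec) _ | [] , col ∷ v@(x ∷ v′) , refl , _ , _ = begin
      weight v                               ≡⟨ go v (rec ≤-refl) (s≤s z≤n) ⟩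
      first v weight + inner v weight        ≡⟨ cong (_+ inner v weight) (next-∷ x v′ weight) ⟨
      leaves (col ∷ v) weight                ∎
    -- A closed word ends in row, and dropping that row only drops a zero part.
    go _ (acc rec) _ | u@(_ ∷ _) , [] , refl , c , _ with closed-snoc c
    ... | [] , refl = trans (weight-∷ʳ []) (sym (+-identityʳ _))
    ... | u′@(y ∷ u″) , refl = begin
      weight ((u′ ∷ʳ row) ++ [])        ≡⟨ cong weight (++-identityʳ (u′ ∷ʳ row)) ⟩
      weight (u′ ∷ʳ row)                ≡⟨ weight-∷ʳ u′ ⟩
      weight u′                         ≡⟨ go u′ (rec shorter) (s≤s z≤n) ⟩
      leaves u′ weight                  ≡⟨ leaves-∷ʳ y u″ weight weight-∷ʳ ⟨
      leaves (u′ ∷ʳ row) weight         ≡⟨ cong (λ w → leaves w weight) (++-identityʳ (u′ ∷ʳ row)) ⟨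
      leaves ((u′ ∷ʳ row) ++ []) weight ∎
      where
      shorter : length u′ < length ((u′ ∷ʳ row) ++ [])
      shorter = ≤-reflexive (sym (trans (cong length (++-identityʳ (u′ ∷ʳ row)))
        (trans (length-++ u′) (+-comm (length u′) 1))))
    go _ (acc rec) _ | u@(x ∷ u′) , v@(col ∷ v′) , refl , c , o = begin
      weight (u ++ v)
        ≡⟨ weight-++ c o ⟩
      ((r + suc q) C r) * weight v * weight u
        ≡⟨ cong (λ n → n * weight v * weight u) (C-pascal q (closed-rows c)) ⟨
      (k₁ + k₂) * weight v * weight u
        ≡⟨ rearrange k₁ k₂ (weight v) (weight u) ⟩
      k₁ * weight v * weight u + k₂ * weight u * weight v
        ≡⟨ cong₂ (λ m n → k₁ * weight v * m + k₂ * weight u * n)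
             (go u (rec (subst (length u <_) (sym (length-++ u)) (m<m+n _ (s≤s z≤n)))) (s≤s z≤n))
             (go v (rec (subst (length v <_) (sym (length-++ u)) (m<n+m _ (s≤s z≤n)))) (s≤s z≤n)) ⟩
      k₁ * weight v * leaves u weight + k₂ * weight u * inner v weight
        ≡⟨ cong₂ _+_ (leaves-closed (k₁ * weight v) c remove-u) (inner-opening (k₂ * weight u) o remove-v) ⟨
      leaves u (weight ∘ (_++ v)) + inner v (weight ∘ (u ++_))
        ≡⟨ +-assoc (first u (weight ∘ (_++ v))) _ _ ⟩
      first u (weight ∘ (_++ v)) + (inner u (weight ∘ (_++ v)) + inner v (weight ∘ (u ++_)))
        ≡⟨ cong₂ _+_ (first-++ x u′ v weight) (inner-++ c v weight) ⟨
      leaves (u ++ v) weight ∎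
      where
      r  = rows u
      q  = cols v′
      k₁ = (pred r + suc q) C pred r
      k₂ = (r + q) C r
      rearrange : ∀ i j m n → (i + j) * m * n ≡ i * m * n + j * n * m
      rearrange = solve-∀
      remove-u : ∀ {w} → Closed 0 w → suc (rows w) ≡ r → weight (w ++ v) ≡ k₁ * weight v * weight w
      remove-u {w} c′ eq = trans (weight-++ c′ o)
        (cong (λ p → ((p + suc q) C p) * weight v * weight w) (cong pred eq))
      remove-v : ∀ {w} → Opening 0 w → suc (cols w) ≡ suc q → weight (u ++ w) ≡ k₂ * weight u * weight w
      remove-v {w} o′ eq = trans (weight-++ c o′) (trans
        (cong (λ p → ((r + p) C r) * weight w * weight u) (cong pred eq)) (swap k₂ (weight w) (weight u)))
        where
        swap : ∀ i m n → i * m * n ≡ i * n * m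
        swap = solve-∀

open Words

-- Partitions in the box and their boundary words

data InBox : ℕ → ∀ {g} → Vec ℕ g → Set where
  []  : ∀ {f} → InBox f []
  _∷_ : ∀ {f g x} {ν : Vec ℕ g} → x ≤ f → InBox x ν → InBox f (x ∷ ν)

𝒫-inBox : ∀ f g → All (InBox f) (𝒫 f g)
𝒫-inBox f zero    = [] ∷ []
𝒫-inBox f (suc g) = All.concat⁺ (All.map⁺
  (All.map (λ {x} x<f → All.map⁺ (All.map (s≤s⁻¹ x<f ∷_) (𝒫-inBox x g))) (All.all-upTo (suc f))))

-- This matches the split of boundary words by first letter: col if the first part is at most f, row
-- if it equals f + 1.
𝒫-suc : ∀ f g → 𝒫 (suc f) (suc g) ≡ 𝒫 f (suc g) ++ map (suc f ∷_) (𝒫 (suc f) g)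
𝒫-suc f g = ≡.trans (≡.cong (concatMap h) (≡.sym (upTo-∷ʳ (suc f))))
  (≡.trans (concatMap-++ h (upTo (suc f)) (suc f ∷ [])) (≡.cong (𝒫 f (suc g) ++_) (++-identityʳ _)))
  where
  h : ℕ → List (Vec ℕ (suc g))
  h x = map (x ∷_) (𝒫 x g)

-- The boundary of ν read from the top right to the bottom left corner of the
-- box; tᵢ swaps the two letters that have i - 1 letters to their right.
path : ∀ {g} → ℕ → Vec ℕ g → Word
path f []      = replicate f col
path f (x ∷ ν) = replicate (f ∸ x) col ++ row ∷ path x ν

cols-replicate : ∀ n w → cols (replicate n col ++ w) ≡ n ℕ.+ cols w
cols-replicate zero    w = ≡.refl
cols-replicate (suc n) w = ≡.cong suc (cols-replicate n w)

rows-replicate : ∀ n w → rows (replicate n col ++ w) ≡ rows w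
rows-replicate zero    w = ≡.refl
rows-replicate (suc n) w = rows-replicate n w

parts-replicate : ∀ n w → parts (replicate n col ++ w) ≡ parts w
parts-replicate zero    w = ≡.refl
parts-replicate (suc n) w = parts-replicate n w

cols-path : ∀ {f g} {ν : Vec ℕ g} → InBox f ν → cols (path f ν) ≡ f
cols-path {f} [] = ≡.trans (≡.cong cols (≡.sym (++-identityʳ (replicate f col))))
  (≡.trans (cols-replicate f []) (ℕ.+-identityʳ f))
cols-path {f} {ν = x ∷ ν} (x≤f ∷ β) = ≡.trans (cols-replicate (f ∸ x) (row ∷ path x ν))
  (≡.trans (≡.cong (f ∸ x ℕ.+_) (cols-path β)) (ℕ.m∸n+n≡m x≤f))

rows-path : ∀ {f g} (ν : Vec ℕ g) → rows (path f ν) ≡ g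
rows-path {f} [] = ≡.trans (≡.cong rows (≡.sym (++-identityʳ (replicate f col)))) (rows-replicate f [])
rows-path {f} (x ∷ ν) = ≡.trans (rows-replicate (f ∸ x) (row ∷ path x ν)) (≡.cong suc (rows-path ν))

parts-path : ∀ {f g} {ν : Vec ℕ g} → InBox f ν → parts (path f ν) ≡ toList ν
parts-path {f} [] = ≡.trans (≡.cong parts (≡.sym (++-identityʳ (replicate f col)))) (parts-replicate f [])
parts-path {f} {ν = x ∷ ν} (x≤f ∷ β) = ≡.trans (parts-replicate (f ∸ x) (row ∷ path x ν))
  (≡.cong₂ _∷_ (cols-path β) (parts-path β))

path-suc : ∀ {f g} {ν : Vec ℕ g} → InBox f ν → path (suc f) ν ≡ col ∷ path f ν
path-suc [] = ≡.refl
path-suc {ν = x ∷ ν} (x≤f ∷ _) = ≡.cong (λ n → replicate n col ++ row ∷ path x ν) (ℕ.+-∸-assoc 1 x≤f)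

replicate-++-col : ∀ n (w : Word) → replicate n col ++ col ∷ w ≡ col ∷ replicate n col ++ w
replicate-++-col zero    w = ≡.refl
replicate-++-col (suc n) w = ≡.cong (col ∷_) (replicate-++-col n w)

path-+ : ∀ {x g} {ν : Vec ℕ g} d → InBox x ν → path (d ℕ.+ x) ν ≡ replicate d col ++ path x ν
path-+ zero    β = ≡.refl
path-+ (suc d) β = ≡.trans (path-suc (weaken d β)) (≡.cong (col ∷_) (path-+ d β))
  where
  weaken : ∀ {x g} {ν : Vec ℕ g} d → InBox x ν → InBox (d ℕ.+ x) ν
  weaken d []      = []
  weaken d (p ∷ β) = ℕ.≤-trans p (ℕ.m≤n+m _ d) ∷ β

length-cols-rows : ∀ w → length w ≡ cols w ℕ.+ rows w
length-cols-rows []        = ≡.refl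
length-cols-rows (col ∷ w) = ≡.cong suc (length-cols-rows w)
length-cols-rows (row ∷ w) = ≡.trans (≡.cong suc (length-cols-rows w)) (≡.sym (ℕ.+-suc (cols w) (rows w)))

cols-swap : ∀ u x y z → cols (u ++ x ∷ y ∷ z) ≡ cols (u ++ y ∷ x ∷ z)
cols-swap []        col col z = ≡.refl
cols-swap []        col row z = ≡.refl
cols-swap []        row col z = ≡.refl
cols-swap []        row row z = ≡.refl
cols-swap (col ∷ u) x   y   z = ≡.cong suc (cols-swap u x y z)
cols-swap (row ∷ u) x   y   z = cols-swap u x y z

rows-swap : ∀ u x y z → rows (u ++ x ∷ y ∷ z) ≡ rows (u ++ y ∷ x ∷ z)
rows-swap []        col col z = ≡.refl
rows-swap []        col row z = ≡.refl
rows-swap []        row col z = ≡.refl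
rows-swap []        row row z = ≡.refl
rows-swap (col ∷ u) x   y   z = rows-swap u x y z
rows-swap (row ∷ u) x   y   z = ≡.cong suc (rows-swap u x y z)

-- Alternating sums over words in an abelian group

module CupExpansion {c ℓ} (A : AbelianGroup c ℓ) where

  open AbelianGroup A
    renaming (Carrier to X; _∙_ to _+_; ε to 0#; ∙-cong to +-cong; ∙-congˡ to +-congˡ; ∙-congʳ to +-congʳ;
              identityˡ to +-identityˡ; identityʳ to +-identityʳ)
  open AbelianGroupProperties A using (⁻¹-∙-comm; ε⁻¹≈ε; ⁻¹-anti-homo‿-)
  open CommutativeSemigroupProperties commutativeSemigroup using (interchange)
  open Mult commutativeMonoid using (×-congˡ; ×-congʳ; ×-homo-1; ×-homo-+; ×-distrib-+) renaming (_×_ to _×ₙ_)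
  open CommutativeMonoidSolver commutativeMonoid using (solve; _⊜_; _⊕_)
  open SetoidReasoning setoid

  sub-cong : ∀ {x y u v} → x ≈ y → u ≈ v → x - u ≈ y - v
  sub-cong p q = +-cong p (⁻¹-cong q)

  sub-zero : ∀ x → x - 0# ≈ x
  sub-zero x = trans (+-congˡ ε⁻¹≈ε) (+-identityʳ x)

  +-sub-interchange : ∀ x y u v → (x - y) + (u - v) ≈ (x + u) - (y + v)
  +-sub-interchange x y u v = trans (interchange x (y ⁻¹) u (v ⁻¹)) (+-congˡ (⁻¹-∙-comm y v))

  sub-sub-interchange : ∀ x y u v → (x - y) - (u - v) ≈ (x - u) - (y - v)
  sub-sub-interchange x y u v = trans (+-congˡ (sym (⁻¹-∙-comm u (v ⁻¹))))
    (trans (interchange x (y ⁻¹) (u ⁻¹) (v ⁻¹ ⁻¹)) (+-congˡ (⁻¹-∙-comm y (v ⁻¹))))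

  ∑ʷ : ℕ → (Word → X) → X
  ∑ʷ zero    ψ = ψ []
  ∑ʷ (suc n) ψ = ∑ʷ n (ψ ∘ (col ∷_)) + ∑ʷ n (ψ ∘ (row ∷_))

  ∑ʷ-cong : ∀ n {ψ φ} → (∀ w → ψ w ≈ φ w) → ∑ʷ n ψ ≈ ∑ʷ n φ
  ∑ʷ-cong zero    e = e []
  ∑ʷ-cong (suc n) e = +-cong (∑ʷ-cong n (e ∘ (col ∷_))) (∑ʷ-cong n (e ∘ (row ∷_)))

  ∑ʷ-+ : ∀ n ψ φ → ∑ʷ n (λ w → ψ w + φ w) ≈ ∑ʷ n ψ + ∑ʷ n φ
  ∑ʷ-+ zero    ψ φ = refl
  ∑ʷ-+ (suc n) ψ φ = trans (+-cong (∑ʷ-+ n _ _) (∑ʷ-+ n _ _)) (interchange _ _ _ _)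

  ∑ʷ-sub : ∀ n ψ φ → ∑ʷ n (λ w → ψ w - φ w) ≈ ∑ʷ n ψ - ∑ʷ n φ
  ∑ʷ-sub zero    ψ φ = refl
  ∑ʷ-sub (suc n) ψ φ = trans (+-cong (∑ʷ-sub n _ _) (∑ʷ-sub n _ _)) (+-sub-interchange _ _ _ _)

  ∑ʷ-0 : ∀ n {ψ} → (∀ w → ψ w ≈ 0#) → ∑ʷ n ψ ≈ 0#
  ∑ʷ-0 zero    e = e []
  ∑ʷ-0 (suc n) e = trans (+-cong (∑ʷ-0 n (e ∘ (col ∷_))) (∑ʷ-0 n (e ∘ (row ∷_)))) (+-identityˡ 0#)

  inserts : Word → (Word → X) → X
  inserts []      G = G (col ∷ row ∷ [])
  inserts (x ∷ w) G = G (col ∷ row ∷ x ∷ w) + inserts w (G ∘ (x ∷_))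

  inserts-sub : ∀ w G H → inserts w (λ u → G u - H u) ≈ inserts w G - inserts w H
  inserts-sub []      G H = refl
  inserts-sub (x ∷ w) G H = trans (+-congˡ (inserts-sub w _ _)) (+-sub-interchange _ _ _ _)

  -- Indexed so that the words reaching `G` have length n + 1, as in the neighbouring sums; a factor
  -- of two letters has no room when n is 0.
  ∑-inserts : ℕ → (Word → ℕ) → (Word → X) → X
  ∑-inserts zero    Φ G = 0#
  ∑-inserts (suc n) Φ G = ∑ʷ n (λ w → Φ w ×ₙ inserts w G)

  ∑-inserts-suc : ∀ n Φ G → ∑-inserts (suc n) Φ G ≈ ∑ʷ n (λ w → Φ w ×ₙ G (col ∷ row ∷ w)) +
    (∑-inserts n (Φ ∘ (col ∷_)) (G ∘ (col ∷_)) + ∑-inserts n (Φ ∘ (row ∷_)) (G ∘ (row ∷_)))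
  ∑-inserts-suc zero Φ G = sym (trans (+-congˡ (+-identityˡ 0#)) (+-identityʳ _))
  ∑-inserts-suc (suc n) Φ G = trans (+-cong (go col) (go row)) (interchange _ _ _ _)
    where
    go : ∀ x → ∑ʷ n (λ w → Φ (x ∷ w) ×ₙ inserts (x ∷ w) G) ≈
      ∑ʷ n (λ w → Φ (x ∷ w) ×ₙ G (col ∷ row ∷ x ∷ w)) + ∑-inserts (suc n) (Φ ∘ (x ∷_)) (G ∘ (x ∷_))
    go x = trans (∑ʷ-cong n λ w → ×-distrib-+ _ _ (Φ (x ∷ w))) (∑ʷ-+ n _ _)

  ∑-first : ∀ n Φ (G : Word → X) → ∑ʷ (suc n) (λ w → first w Φ ×ₙ G w) ≈ ∑ʷ n (λ w → Φ w ×ₙ G (row ∷ w))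
  ∑-first n Φ G = trans (+-congʳ (∑ʷ-0 n λ _ → refl)) (+-identityˡ _)

  ∑-next : ∀ n Φ (G : Word → X) → ∑ʷ (suc n) (λ w → next w Φ ×ₙ G w) ≈ ∑ʷ n (λ w → Φ w ×ₙ G (row ∷ w))
  ∑-next n Φ G = trans (+-congʳ (∑ʷ-0 n λ _ → refl)) (+-identityˡ _)

  -- Double counting: a word with a marked leaf is the same as the remaining word with a place where
  -- the leaf is put back.
  ∑-inner : ∀ n Φ G → ∑ʷ (suc n) (λ w → inner w Φ ×ₙ G w) ≈
    ∑ʷ n (λ w → Φ w ×ₙ G (w ∷ʳ col)) + ∑-inserts n Φ G
  ∑-inner zero Φ G = +-congʳ (×-congˡ (ℕ.+-identityʳ (Φ [])))
  ∑-inner (suc n) Φ G = begin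
    ∑ʷ (suc n) (λ w → (next w Φ ℕ.+ inner w (Φ ∘ (col ∷_))) ×ₙ G (col ∷ w)) +
      ∑ʷ (suc n) (λ w → inner w (Φ ∘ (row ∷_)) ×ₙ G (row ∷ w))
      ≈⟨ +-cong
           (trans (∑ʷ-cong (suc n) λ w → ×-homo-+ (G (col ∷ w)) (next w Φ) (inner w (Φ ∘ (col ∷_)))) (trans
             (∑ʷ-+ (suc n) (λ w → next w Φ ×ₙ G (col ∷ w)) (λ w → inner w (Φ ∘ (col ∷_)) ×ₙ G (col ∷ w)))
             (+-cong (∑-next n Φ (G ∘ (col ∷_))) (∑-inner n (Φ ∘ (col ∷_)) (G ∘ (col ∷_))))))
           (∑-inner n (Φ ∘ (row ∷_)) (G ∘ (row ∷_))) ⟩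
    (∑ʷ n (λ w → Φ w ×ₙ G (col ∷ row ∷ w)) + (_ + _)) + (_ + _)
      ≈⟨ solve 5 (λ a b c d e → (a ⊕ (b ⊕ c)) ⊕ (d ⊕ e) ⊜ (b ⊕ d) ⊕ (a ⊕ (c ⊕ e))) refl _ _ _ _ _ ⟩
    ∑ʷ (suc n) (λ w → Φ w ×ₙ G (w ∷ʳ col)) + (_ + (_ + _))
      ≈⟨ +-congˡ (∑-inserts-suc n Φ G) ⟨
    ∑ʷ (suc n) (λ w → Φ w ×ₙ G (w ∷ʳ col)) + ∑-inserts (suc n) Φ G ∎

  cups : Word → (Word → X) → X
  cups []      ψ = ψ (col ∷ row ∷ []) - ψ (row ∷ col ∷ [])
  cups (x ∷ u) ψ = (ψ (col ∷ row ∷ x ∷ u) - ψ (row ∷ col ∷ x ∷ u)) + cups u (ψ ∘ (x ∷_))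

  ∑-cups : ℕ → (Word → X) → X
  ∑-cups zero    ψ = 0#
  ∑-cups (suc n) ψ = ∑ʷ n (λ u → cups u ψ)

  ∑-cups-suc : ∀ n ψ → ∑-cups (suc n) ψ ≈
    (∑ʷ n (λ u → ψ (col ∷ row ∷ u)) - ∑ʷ n (λ u → ψ (row ∷ col ∷ u))) +
    (∑-cups n (ψ ∘ (col ∷_)) + ∑-cups n (ψ ∘ (row ∷_)))
  ∑-cups-suc zero ψ = sym (trans (+-congˡ (+-identityˡ 0#)) (+-identityʳ _))
  ∑-cups-suc (suc n) ψ = trans (+-cong (go col) (go row))
    (trans (interchange _ _ _ _) (+-congʳ (+-sub-interchange _ _ _ _)))
    where
    go : ∀ x → ∑ʷ n (λ u → cups (x ∷ u) ψ) ≈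
      (∑ʷ n (λ u → ψ (col ∷ row ∷ x ∷ u)) - ∑ʷ n (λ u → ψ (row ∷ col ∷ x ∷ u))) + ∑-cups (suc n) (ψ ∘ (x ∷_))
    go x = trans (∑ʷ-+ n _ _) (+-congʳ (∑ʷ-sub n _ _))

  -- Inserting col row minus inserting row col at position i is the sum over
  -- words with col at position i minus that over words with col at position
  -- i+1, so the sum over i telescopes.
  ∑ʷ-telescope : ∀ n ψ →
    (∑ʷ n (ψ ∘ (row ∷_)) + ∑ʷ n (ψ ∘ (_∷ʳ col))) + ∑-cups n ψ ≈ ∑ʷ (suc n) ψ
  ∑ʷ-telescope zero ψ = trans (+-identityʳ _) (comm _ _)
  ∑ʷ-telescope (suc n) ψ = begin
    ((rc + rr) + (c-c + r-c)) + ∑-cups (suc n) ψ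
      ≈⟨ +-congˡ (∑-cups-suc n ψ) ⟩
    ((rc + rr) + (c-c + r-c)) + ((cr - rc) + (tc + tr))
      ≈⟨ solve 8 (λ rc rr c-c r-c cr -rc tc tr →
           ((rc ⊕ rr) ⊕ (c-c ⊕ r-c)) ⊕ ((cr ⊕ -rc) ⊕ (tc ⊕ tr)) ⊜
           (((cr ⊕ c-c) ⊕ tc) ⊕ ((rr ⊕ r-c) ⊕ tr)) ⊕ (rc ⊕ -rc)) refl rc rr c-c r-c cr (rc ⁻¹) tc tr ⟩
    (((cr + c-c) + tc) + ((rr + r-c) + tr)) + (rc - rc)
      ≈⟨ +-cong (+-cong (∑ʷ-telescope n (ψ ∘ (col ∷_))) (∑ʷ-telescope n (ψ ∘ (row ∷_)))) (inverseʳ rc) ⟩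
    ∑ʷ (suc (suc n)) ψ + 0#
      ≈⟨ +-identityʳ _ ⟩
    ∑ʷ (suc (suc n)) ψ ∎
    where
    cr  = ∑ʷ n (λ u → ψ (col ∷ row ∷ u))
    rc  = ∑ʷ n (λ u → ψ (row ∷ col ∷ u))
    rr  = ∑ʷ n (λ u → ψ (row ∷ row ∷ u))
    c-c = ∑ʷ n (λ u → ψ (col ∷ u ∷ʳ col))
    r-c = ∑ʷ n (λ u → ψ (row ∷ u ∷ʳ col))
    tc  = ∑-cups n (ψ ∘ (col ∷_))
    tr  = ∑-cups n (ψ ∘ (row ∷_))

  -- A bracket left open has no partner to be swapped with. Killing the branch in which it became
  -- row leaves an unmatched col contributing just itself.
  close : List Step → X → X
  close []        x = x
  close (col ∷ σ) x = close σ x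
  close (row ∷ σ) x = 0#

  -- Each matched pair of brackets of w contributes col⋯row minus row⋯col, and
  -- an unmatched bracket contributes itself; ψ is applied to the words of the
  -- resulting alternating sum.  The stack σ holds the letters already chosen
  -- for the brackets that are open.
  expand : List Step → Word → (Word → X) → X
  expand σ         []        ψ = close σ (ψ [])
  expand σ         (col ∷ w) ψ = expand (col ∷ σ) w (ψ ∘ (col ∷_)) - expand (row ∷ σ) w (ψ ∘ (row ∷_))
  expand []        (row ∷ w) ψ = expand [] w (ψ ∘ (row ∷_))
  expand (col ∷ σ) (row ∷ w) ψ = expand σ w (ψ ∘ (row ∷_))
  expand (row ∷ σ) (row ∷ w) ψ = expand σ w (ψ ∘ (col ∷_))

  expand-cong : ∀ σ w {ψ φ} → (∀ u → length u ≡ length w → ψ u ≈ φ u) → expand σ w ψ ≈ expand σ w φ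
  expand-cong [] [] e = e [] ≡.refl
  expand-cong (col ∷ σ) [] e = expand-cong σ [] e
  expand-cong (row ∷ σ) [] e = refl
  expand-cong σ (col ∷ w) e = sub-cong
    (expand-cong (col ∷ σ) w λ u p → e (col ∷ u) (≡.cong suc p))
    (expand-cong (row ∷ σ) w λ u p → e (row ∷ u) (≡.cong suc p))
  expand-cong [] (row ∷ w) e = expand-cong [] w λ u p → e (row ∷ u) (≡.cong suc p)
  expand-cong (col ∷ σ) (row ∷ w) e = expand-cong σ w λ u p → e (row ∷ u) (≡.cong suc p)
  expand-cong (row ∷ σ) (row ∷ w) e = expand-cong σ w λ u p → e (col ∷ u) (≡.cong suc p)

  expand-hom : ∀ (h : X → X) → (∀ {x y} → x ≈ y → h x ≈ h y) → h 0# ≈ 0# → (∀ x y → h (x - y) ≈ h x - h y) →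
    ∀ σ w ψ → h (expand σ w ψ) ≈ expand σ w (h ∘ ψ)
  expand-hom h h-cong h-0 h-sub = go
    where
    go : ∀ σ w ψ → h (expand σ w ψ) ≈ expand σ w (h ∘ ψ)
    go [] [] ψ = refl
    go (col ∷ σ) [] ψ = go σ [] ψ
    go (row ∷ σ) [] ψ = h-0
    go σ (col ∷ w) ψ = trans (h-sub _ _) (sub-cong (go (col ∷ σ) w _) (go (row ∷ σ) w _))
    go [] (row ∷ w) ψ = go [] w _
    go (col ∷ σ) (row ∷ w) ψ = go σ w _
    go (row ∷ σ) (row ∷ w) ψ = go σ w _

  expand-hom₂ : ∀ (_∙_ : X → X → X) → 0# ∙ 0# ≈ 0# → (∀ {x y u v} → x ≈ y → u ≈ v → (x ∙ u) ≈ (y ∙ v)) →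
    (∀ x y u v → (x - y) ∙ (u - v) ≈ (x ∙ u) - (y ∙ v)) →
    ∀ σ w ψ φ → expand σ w (λ u → ψ u ∙ φ u) ≈ expand σ w ψ ∙ expand σ w φ
  expand-hom₂ _∙_ 0∙0 ∙-cong ∙-sub = go
    where
    go : ∀ σ w ψ φ → expand σ w (λ u → ψ u ∙ φ u) ≈ expand σ w ψ ∙ expand σ w φ
    go [] [] ψ φ = refl
    go (col ∷ σ) [] ψ φ = go σ [] ψ φ
    go (row ∷ σ) [] ψ φ = sym 0∙0
    go σ (col ∷ w) ψ φ = trans (sub-cong (go (col ∷ σ) w _ _) (go (row ∷ σ) w _ _)) (sym (∙-sub _ _ _ _))
    go [] (row ∷ w) ψ φ = go [] w _ _
    go (col ∷ σ) (row ∷ w) ψ φ = go σ w _ _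
    go (row ∷ σ) (row ∷ w) ψ φ = go σ w _ _

  expand-+ : ∀ σ w ψ φ → expand σ w (λ u → ψ u + φ u) ≈ expand σ w ψ + expand σ w φ
  expand-+ = expand-hom₂ _+_ (+-identityˡ 0#) +-cong +-sub-interchange

  expand-sub : ∀ σ w ψ φ → expand σ w (λ u → ψ u - φ u) ≈ expand σ w ψ - expand σ w φ
  expand-sub = expand-hom₂ _-_ (inverseʳ 0#) sub-cong sub-sub-interchange

  expand-∷ʳ : ∀ σ w ψ → expand σ (w ∷ʳ col) ψ ≈ expand σ w (ψ ∘ (_∷ʳ col))
  expand-∷ʳ σ [] ψ = sub-zero _
  expand-∷ʳ σ (col ∷ w) ψ = sub-cong (expand-∷ʳ (col ∷ σ) w _) (expand-∷ʳ (row ∷ σ) w _)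
  expand-∷ʳ [] (row ∷ w) ψ = expand-∷ʳ [] w _
  expand-∷ʳ (col ∷ σ) (row ∷ w) ψ = expand-∷ʳ σ w _
  expand-∷ʳ (row ∷ σ) (row ∷ w) ψ = expand-∷ʳ σ w _

  -- An inserted col row is matched with itself and disturbs no other pair, so it contributes col
  -- row minus row col on the spot.
  inserts-expand : ∀ σ w ψ → inserts w (λ v → expand σ v ψ) ≈ expand σ w (λ u → cups u ψ)
  inserts-expand σ [] ψ = sym (expand-sub σ [] (ψ ∘ (λ u → col ∷ row ∷ u)) (ψ ∘ (λ u → row ∷ col ∷ u)))
  inserts-expand σ (x ∷ w) ψ = go σ x
    where
    α : Word → X
    α u = ψ (col ∷ row ∷ u) - ψ (row ∷ col ∷ u)
    step : ∀ τ x → expand τ w (λ u → cups (x ∷ u) ψ) ≈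
      expand τ w (α ∘ (x ∷_)) + inserts w (λ v → expand τ v (ψ ∘ (x ∷_)))
    step τ x = trans (expand-+ τ w (α ∘ (x ∷_)) (λ u → cups u (ψ ∘ (x ∷_))))
      (+-congˡ (sym (inserts-expand τ w (ψ ∘ (x ∷_)))))
    head : ∀ σ x → expand σ (col ∷ row ∷ x ∷ w) ψ ≈ expand σ (x ∷ w) α
    head σ x = sym (expand-sub σ (x ∷ w) (ψ ∘ (λ u → col ∷ row ∷ u)) (ψ ∘ (λ u → row ∷ col ∷ u)))
    go : ∀ σ x → inserts (x ∷ w) (λ v → expand σ v ψ) ≈ expand σ (x ∷ w) (λ u → cups u ψ)
    go σ col = begin
      expand σ (col ∷ row ∷ col ∷ w) ψ + inserts w (λ v → expand σ (col ∷ v) ψ)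
        ≈⟨ +-cong (head σ col) (inserts-sub w _ _) ⟩
      expand σ (col ∷ w) α +
        (inserts w (λ v → expand (col ∷ σ) v (ψ ∘ (col ∷_))) - inserts w (λ v → expand (row ∷ σ) v (ψ ∘ (row ∷_))))
        ≈⟨ +-sub-interchange _ _ _ _ ⟩
      (expand (col ∷ σ) w (α ∘ (col ∷_)) + inserts w (λ v → expand (col ∷ σ) v (ψ ∘ (col ∷_)))) -
        (expand (row ∷ σ) w (α ∘ (row ∷_)) + inserts w (λ v → expand (row ∷ σ) v (ψ ∘ (row ∷_))))
        ≈⟨ sub-cong (step (col ∷ σ) col) (step (row ∷ σ) row) ⟨
      expand σ (col ∷ w) (λ u → cups u ψ) ∎
    go [] row = trans (+-congʳ (head [] row)) (sym (step [] row))
    go (col ∷ σ) row = trans (+-congʳ (head (col ∷ σ) row)) (sym (step σ row))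
    go (row ∷ σ) row = trans (+-congʳ (head (row ∷ σ) row)) (sym (step σ col))

  -- The function has to be arbitrary: the induction applies the statement to `ψ` after prepending
  -- row, to `ψ` after appending col, and, two letters down, to the sum `cups` over all positions.
  ∑ʷ-expand : ∀ n ψ → ∑ʷ n (λ w → weight w ×ₙ expand [] w ψ) ≈ ∑ʷ n ψ
  ∑ʷ-expand zero ψ = trans (×-congˡ weight-[]) (×-homo-1 _)
  ∑ʷ-expand (suc n) ψ = begin
    ∑ʷ (suc n) (λ w → weight w ×ₙ G w)
      ≈⟨ +-cong (∑ʷ-cong n λ w → ×-congˡ (weight-leaves col w)) (∑ʷ-cong n λ w → ×-congˡ (weight-leaves row w)) ⟩
    ∑ʷ (suc n) (λ w → leaves w weight ×ₙ G w)
      ≈⟨ ∑ʷ-cong (suc n) (λ w → ×-homo-+ (G w) (first w weight) (inner w weight)) ⟩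
    ∑ʷ (suc n) (λ w → first w weight ×ₙ G w + inner w weight ×ₙ G w)
      ≈⟨ ∑ʷ-+ (suc n) (λ w → first w weight ×ₙ G w) (λ w → inner w weight ×ₙ G w) ⟩
    ∑ʷ (suc n) (λ w → first w weight ×ₙ G w) + ∑ʷ (suc n) (λ w → inner w weight ×ₙ G w)
      ≈⟨ +-cong (∑-first n weight G) (∑-inner n weight G) ⟩
    ∑ʷ n (λ w → weight w ×ₙ G (row ∷ w)) + (∑ʷ n (λ w → weight w ×ₙ G (w ∷ʳ col)) + ∑-inserts n weight G)
      ≈⟨ assoc _ _ _ ⟨
    (∑ʷ n (λ w → weight w ×ₙ G (row ∷ w)) + ∑ʷ n (λ w → weight w ×ₙ G (w ∷ʳ col))) + ∑-inserts n weight G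
      ≈⟨ +-cong (+-cong (∑ʷ-expand n (ψ ∘ (row ∷_)))
           (trans (∑ʷ-cong n λ w → ×-congʳ (weight w) (expand-∷ʳ [] w ψ)) (∑ʷ-expand n (ψ ∘ (_∷ʳ col)))))
           (∑-inserts-cups n) ⟩
    (∑ʷ n (ψ ∘ (row ∷_)) + ∑ʷ n (ψ ∘ (_∷ʳ col))) + ∑-cups n ψ
      ≈⟨ ∑ʷ-telescope n ψ ⟩
    ∑ʷ (suc n) ψ ∎
    where
    G : Word → X
    G w = expand [] w ψ
    ∑-inserts-cups : ∀ n → ∑-inserts n weight G ≈ ∑-cups n ψ
    ∑-inserts-cups zero    = refl
    ∑-inserts-cups (suc n) = trans (∑ʷ-cong n λ w → ×-congʳ (weight w) (inserts-expand [] w ψ))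
      (∑ʷ-expand n (λ u → cups u ψ))

  -- Swapping a pair preserves the shape. A row on the stack marks a pair swapped but not yet
  -- closed, whose closing row will be written as col; this accounts for the corrections by
  -- `rows σ`.
  expand-vanish : ∀ σ w {ψ} → (∀ u → cols u ≡ cols w ℕ.+ rows σ → rows u ℕ.+ rows σ ≡ rows w → ψ u ≈ 0#) →
    expand σ w ψ ≈ 0#
  expand-vanish []        [] e = e [] ≡.refl ≡.refl
  expand-vanish (col ∷ σ) [] e = expand-vanish σ [] e
  expand-vanish (row ∷ σ) [] e = refl
  expand-vanish σ (col ∷ w) e = trans
    (sub-cong (expand-vanish (col ∷ σ) w λ u p q → e (col ∷ u) (≡.cong suc p) q)
      (expand-vanish (row ∷ σ) w λ u p q → e (row ∷ u)
        (≡.trans p (ℕ.+-suc (cols w) (rows σ))) (≡.trans (≡.sym (ℕ.+-suc (rows u) (rows σ))) q)))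
    (inverseʳ 0#)
  expand-vanish [] (row ∷ w) e = expand-vanish [] w λ u p q → e (row ∷ u) p (≡.cong suc q)
  expand-vanish (col ∷ σ) (row ∷ w) e = expand-vanish σ w λ u p q → e (row ∷ u) p (≡.cong suc q)
  expand-vanish (row ∷ σ) (row ∷ w) e = expand-vanish σ w λ u p q → e (col ∷ u)
    (≡.trans (≡.cong suc p) (≡.sym (ℕ.+-suc (cols w) (rows σ)))) (≡.trans (ℕ.+-suc (rows u) (rows σ)) (≡.cong suc q))

  -- A col at the bottom of the stack acts like the empty stack: it turns a row
  -- into itself, and may be left unclosed.
  expand-bottom : ∀ σ w ψ → expand (σ ∷ʳ col) w ψ ≈ expand σ w ψ
  expand-bottom []        [] ψ = refl
  expand-bottom (col ∷ σ) [] ψ = expand-bottom σ [] ψ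
  expand-bottom (row ∷ σ) [] ψ = refl
  expand-bottom σ (col ∷ w) ψ = sub-cong (expand-bottom (col ∷ σ) w _) (expand-bottom (row ∷ σ) w _)
  expand-bottom []        (row ∷ w) ψ = refl
  expand-bottom (col ∷ σ) (row ∷ w) ψ = expand-bottom σ w _
  expand-bottom (row ∷ σ) (row ∷ w) ψ = expand-bottom σ w _

  -- Here `φ` stands for t_i - 1 applied to `ψ`. It vanishes on equal letters, so of the two choices
  -- for the opening col only the one differing from the letter written for the row survives. The
  -- surviving difference is the new adjacent pair, and the letter chosen for the former partner of
  -- the row now waits for the former partner of the col.
  expand-swap : ∀ σ u z {ψ φ} →
    (∀ p x y q → length p ≡ length u → length q ≡ length z →
      φ (p ++ x ∷ y ∷ q) ≈ ψ (p ++ y ∷ x ∷ q) - ψ (p ++ x ∷ y ∷ q)) →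
    expand σ (u ++ row ∷ col ∷ z) φ ≈ expand σ (u ++ col ∷ row ∷ z) ψ
  expand-swap σ (col ∷ u) z e = sub-cong
    (expand-swap (col ∷ σ) u z λ p x y q r → e (col ∷ p) x y q (≡.cong suc r))
    (expand-swap (row ∷ σ) u z λ p x y q r → e (row ∷ p) x y q (≡.cong suc r))
  expand-swap [] (row ∷ u) z e = expand-swap [] u z λ p x y q r → e (row ∷ p) x y q (≡.cong suc r)
  expand-swap (col ∷ σ) (row ∷ u) z e = expand-swap σ u z λ p x y q r → e (row ∷ p) x y q (≡.cong suc r)
  expand-swap (row ∷ σ) (row ∷ u) z e = expand-swap σ u z λ p x y q r → e (col ∷ p) x y q (≡.cong suc r)
  expand-swap σ [] z {ψ} {φ} e = go σ
    where
    diff : ∀ τ x y → expand τ z (λ q → φ (x ∷ y ∷ q)) ≈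
      expand τ z (λ q → ψ (y ∷ x ∷ q)) - expand τ z (λ q → ψ (x ∷ y ∷ q))
    diff τ x y = trans (expand-cong τ z λ q r → e [] x y q ≡.refl r)
      (expand-sub τ z (λ q → ψ (y ∷ x ∷ q)) (λ q → ψ (x ∷ y ∷ q)))
    go : ∀ σ → expand σ (row ∷ col ∷ z) φ ≈ expand σ (col ∷ row ∷ z) ψ
    -- The row had no partner, so after re-pairing the closing partner of the col has none either;
    -- `expand-bottom` discards the col still on the stack.
    go [] = begin
      expand (col ∷ []) z (λ q → φ (row ∷ col ∷ q)) - expand (row ∷ []) z (λ q → φ (row ∷ row ∷ q))
        ≈⟨ sub-cong (expand-bottom [] z _) (trans (diff _ row row) (inverseʳ _)) ⟩
      expand [] z (λ q → φ (row ∷ col ∷ q)) - 0#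
        ≈⟨ sub-zero _ ⟩
      expand [] z (λ q → φ (row ∷ col ∷ q))
        ≈⟨ diff [] row col ⟩
      expand [] (col ∷ row ∷ z) ψ ∎
    go (col ∷ σ) = trans (sub-cong (diff _ row col) (trans (diff _ row row) (inverseʳ _))) (sub-zero _)
    go (row ∷ σ) = begin
      expand (col ∷ σ) z (λ q → φ (col ∷ col ∷ q)) - expand (row ∷ σ) z (λ q → φ (col ∷ row ∷ q))
        ≈⟨ sub-cong (trans (diff _ col col) (inverseʳ _)) (diff _ col row) ⟩
      0# - (expand (row ∷ σ) z (λ q → ψ (row ∷ col ∷ q)) - expand (row ∷ σ) z (λ q → ψ (col ∷ row ∷ q)))
        ≈⟨ trans (+-identityˡ _) (⁻¹-anti-homo‿- _ _) ⟩
      expand (row ∷ σ) (col ∷ row ∷ z) ψ ∎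

  expand-sorted : ∀ g f ψ → expand [] (replicate g row ++ replicate f col) ψ ≈ ψ (replicate g row ++ replicate f col)
  expand-sorted (suc g) f ψ = expand-sorted g f (ψ ∘ (row ∷_))
  expand-sorted zero    f ψ = go [] f ψ
    where
    go : ∀ σ f ψ → expand σ (replicate f col) ψ ≈ close σ (ψ (replicate f col))
    go σ zero    ψ = refl
    go σ (suc f) ψ = trans (sub-cong (go (col ∷ σ) f _) (go (row ∷ σ) f _)) (sub-zero _)

  -- From sums over words to partitions, from monomials to words

  ∑ : ∀ {b} {B : Set b} → List B → (B → X) → X
  ∑ xs φ = foldr _+_ 0# (map φ xs)

  ∑-cong : ∀ {b} {B : Set b} {xs : List B} {φ χ : B → X} → All (λ x → φ x ≈ χ x) xs → ∑ xs φ ≈ ∑ xs χ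
  ∑-cong []       = refl
  ∑-cong (e ∷ es) = +-cong e (∑-cong es)

  ∑-++ : ∀ {b} {B : Set b} (xs ys : List B) (φ : B → X) → ∑ (xs ++ ys) φ ≈ ∑ xs φ + ∑ ys φ
  ∑-++ []       ys φ = sym (+-identityˡ _)
  ∑-++ (x ∷ xs) ys φ = trans (+-congˡ (∑-++ xs ys φ)) (sym (assoc _ _ _))

  ∑-map : ∀ {b d} {B : Set b} {D : Set d} (h : B → D) (xs : List B) (φ : D → X) → ∑ (map h xs) φ ≈ ∑ xs (φ ∘ h)
  ∑-map h []       φ = refl
  ∑-map h (x ∷ xs) φ = +-congˡ (∑-map h xs φ)

  Supported : ℕ → ℕ → (Word → X) → Set _
  Supported f g χ = ∀ w → ¬ (cols w ≡ f × rows w ≡ g) → χ w ≈ 0#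

  ∑ʷ-𝒫 : ∀ f g χ → Supported f g χ → ∑ʷ (f ℕ.+ g) χ ≈ ∑ (𝒫 f g) (χ ∘ path f)
  ∑ʷ-𝒫 zero zero χ s = sym (+-identityʳ _)
  ∑ʷ-𝒫 zero (suc g) χ s = begin
    ∑ʷ g (χ ∘ (col ∷_)) + ∑ʷ g (χ ∘ (row ∷_))
      ≈⟨ +-cong (∑ʷ-0 g λ w → s (col ∷ w) λ ()) (∑ʷ-𝒫 zero g _ λ w p → s (row ∷ w) λ (i , j) → p (i , ℕ.suc-injective j)) ⟩
    0# + ∑ (𝒫 zero g) (χ ∘ (row ∷_) ∘ path zero)
      ≈⟨ +-identityˡ _ ⟩
    ∑ (𝒫 zero g) (χ ∘ (row ∷_) ∘ path zero)
      ≈⟨ ∑-map (zero ∷_) (𝒫 zero g) (χ ∘ path zero) ⟨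
    ∑ (map (zero ∷_) (𝒫 zero g)) (χ ∘ path zero)
      ≡⟨ ≡.cong (λ xs → ∑ xs (χ ∘ path zero)) (++-identityʳ (map (zero ∷_) (𝒫 zero g))) ⟨
    ∑ (𝒫 zero (suc g)) (χ ∘ path zero) ∎
  ∑ʷ-𝒫 (suc f) zero χ s = begin
    ∑ʷ (f ℕ.+ 0) (χ ∘ (col ∷_)) + ∑ʷ (f ℕ.+ 0) (χ ∘ (row ∷_))
      ≈⟨ +-cong (∑ʷ-𝒫 f zero _ λ w p → s (col ∷ w) λ (i , j) → p (ℕ.suc-injective i , j))
           (∑ʷ-0 (f ℕ.+ 0) λ w → s (row ∷ w) λ ()) ⟩
    ∑ (𝒫 (suc f) zero) (χ ∘ path (suc f)) + 0#
      ≈⟨ +-identityʳ _ ⟩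
    ∑ (𝒫 (suc f) zero) (χ ∘ path (suc f)) ∎
  ∑ʷ-𝒫 (suc f) (suc g) χ s = begin
    ∑ʷ (f ℕ.+ suc g) (χ ∘ (col ∷_)) + ∑ʷ (f ℕ.+ suc g) (χ ∘ (row ∷_))
      ≡⟨ ≡.cong (λ n → ∑ʷ (f ℕ.+ suc g) (χ ∘ (col ∷_)) + ∑ʷ n (χ ∘ (row ∷_))) (ℕ.+-suc f g) ⟩
    ∑ʷ (f ℕ.+ suc g) (χ ∘ (col ∷_)) + ∑ʷ (suc f ℕ.+ g) (χ ∘ (row ∷_))
      ≈⟨ +-cong (∑ʷ-𝒫 f (suc g) _ λ w p → s (col ∷ w) λ (i , j) → p (ℕ.suc-injective i , j))
           (∑ʷ-𝒫 (suc f) g _ λ w p → s (row ∷ w) λ (i , j) → p (i , ℕ.suc-injective j)) ⟩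
    ∑ (𝒫 f (suc g)) (χ ∘ (col ∷_) ∘ path f) + ∑ (𝒫 (suc f) g) (χ ∘ (row ∷_) ∘ path (suc f))
      ≈⟨ +-cong (∑-cong (All.map (λ β → reflexive (≡.cong χ (≡.sym (path-suc β)))) (𝒫-inBox f (suc g))))
           (∑-cong (All.universal (λ ν → reflexive (≡.cong (λ n → χ (replicate n col ++ row ∷ path (suc f) ν))
             (≡.sym (ℕ.n∸n≡0 f)))) (𝒫 (suc f) g))) ⟩
    ∑ (𝒫 f (suc g)) (χ ∘ path (suc f)) + ∑ (𝒫 (suc f) g) (χ ∘ path (suc f) ∘ (suc f ∷_))
      ≈⟨ +-congˡ (∑-map (suc f ∷_) (𝒫 (suc f) g) (χ ∘ path (suc f))) ⟨
    ∑ (𝒫 f (suc g)) (χ ∘ path (suc f)) + ∑ (map (suc f ∷_) (𝒫 (suc f) g)) (χ ∘ path (suc f))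
      ≈⟨ ∑-++ (𝒫 f (suc g)) _ _ ⟨
    ∑ (𝒫 f (suc g) ++ map (suc f ∷_) (𝒫 (suc f) g)) (χ ∘ path (suc f))
      ≡⟨ ≡.cong (λ xs → ∑ xs (χ ∘ path (suc f))) (𝒫-suc f g) ⟨
    ∑ (𝒫 (suc f) (suc g)) (χ ∘ path (suc f)) ∎

  apply : (ℕ → X → X) → List ℕ → X → X
  apply O is v = foldr O v is

  monomialOp : ∀ {g} → (ℕ → X → X) → ℕ → Vec ℕ g → X → X
  monomialOp O f [] v = v
  monomialOp {suc g} O f (x ∷ ν) v = apply O [ x ℕ.+ g ℕ.+ 1 ⋯ f ℕ.+ g ] (monomialOp O f ν v)

  module _ (O : ℕ → X → X) (O-cong : ∀ i {x y} → x ≈ y → O i x ≈ O i y) where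

    apply-cong : ∀ is {x y} → x ≈ y → apply O is x ≈ apply O is y
    apply-cong []       p = p
    apply-cong (i ∷ is) p = O-cong i (apply-cong is p)

    monomialOp-cong : ∀ f {g} (ν : Vec ℕ g) {x y} → x ≈ y → monomialOp O f ν x ≈ monomialOp O f ν y
    monomialOp-cong f []      e = e
    monomialOp-cong f {suc g} (x ∷ ν) e = apply-cong [ x ℕ.+ g ℕ.+ 1 ⋯ f ℕ.+ g ] (monomialOp-cong f ν e)

    monomialOp-ext : ∀ {O′} → (∀ i x → O i x ≈ O′ i x) → ∀ f {g} (ν : Vec ℕ g) v →
      monomialOp O f ν v ≈ monomialOp O′ f ν v
    monomialOp-ext e f []      v = refl
    monomialOp-ext {O′} e f {suc g} (x ∷ ν) v = trans (apply-cong is (monomialOp-ext e f ν v)) (go is)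
      where
      is = [ x ℕ.+ g ℕ.+ 1 ⋯ f ℕ.+ g ]
      go : ∀ is {v} → apply O is v ≈ apply O′ is v
      go []       = refl
      go (i ∷ is) = trans (O-cong i (go is)) (e i _)

  module _ (k : ℕ) (O : ℕ → X → X) (O-cong : ∀ i {x y} → x ≈ y → O i x ≈ O i y) (e : Word → X)
    (O-swap : ∀ u z → length (u ++ row ∷ col ∷ z) ≡ k →
      O (suc (length z)) (e (u ++ row ∷ col ∷ z)) ≈ e (u ++ col ∷ row ∷ z)) where

    -- The innermost operator has the largest index and meets the first col; `h 0` acts last, on the
    -- last col. The induction therefore moves the last col into `z`, which absorbs the shift from
    -- `h` to `h ∘ suc`.
    apply-swaps : ∀ u d z h → (∀ i → h i ≡ suc (length z) ℕ.+ i) → length (u ++ row ∷ replicate d col ++ z) ≡ k →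
      apply O (applyUpTo h d) (e (u ++ row ∷ replicate d col ++ z)) ≈ e (u ++ replicate d col ++ row ∷ z)
    apply-swaps u zero z h _ _ = refl
    apply-swaps u (suc d) z h hi l = begin
      O (h 0) (apply O (applyUpTo (h ∘ suc) d) (e (u ++ row ∷ col ∷ replicate d col ++ z)))
        ≡⟨ ≡.cong (λ w → O (h 0) (apply O (applyUpTo (h ∘ suc) d) (e (u ++ row ∷ w)))) (replicate-++-col d z) ⟨
      O (h 0) (apply O (applyUpTo (h ∘ suc) d) (e (u ++ row ∷ replicate d col ++ col ∷ z)))
        ≈⟨ O-cong (h 0) (apply-swaps u d (col ∷ z) (h ∘ suc)
             (λ i → ≡.trans (hi (suc i)) (ℕ.+-suc (suc (length z)) i))
             (≡.trans (≡.cong (λ w → length (u ++ row ∷ w)) (replicate-++-col d z)) l)) ⟩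
      O (h 0) (e (u ++ replicate d col ++ row ∷ col ∷ z))
        ≡⟨ ≡.cong₂ (λ i w → O i (e w)) (≡.trans (hi 0) (ℕ.+-identityʳ _)) (≡.sym (++-assoc u (replicate d col) (row ∷ col ∷ z))) ⟩
      O (suc (length z)) (e ((u ++ replicate d col) ++ row ∷ col ∷ z))
        ≈⟨ O-swap (u ++ replicate d col) z (≡.trans len l) ⟩
      e ((u ++ replicate d col) ++ col ∷ row ∷ z)
        ≡⟨ ≡.cong e (≡.trans (++-assoc u (replicate d col) (col ∷ row ∷ z)) (≡.cong (u ++_) (replicate-++-col d (row ∷ z)))) ⟩
      e (u ++ col ∷ replicate d col ++ row ∷ z) ∎
      where
      len : length ((u ++ replicate d col) ++ row ∷ col ∷ z) ≡ length (u ++ row ∷ col ∷ replicate d col ++ z)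
      len = ≡.trans (≡.cong length (++-assoc u (replicate d col) (row ∷ col ∷ z))) (≡.trans (length-++ u)
        (≡.trans (≡.cong (length u ℕ.+_) (go d)) (≡.sym (length-++ u))))
        where
        go : ∀ d → length (replicate d col ++ row ∷ col ∷ z) ≡ suc (suc (length (replicate d col ++ z)))
        go zero    = ≡.refl
        go (suc d) = ≡.cong suc (go d)

    -- Rows are placed from the bottom up, with `u` collecting those still waiting. Once the lower
    -- rows are in place the current row stands before `path f ν`, which begins with f - x cols, and
    -- its factor carries it past exactly these. Both sides of the theorem use this: `T` with the
    -- values of `ψ`, and `S` with the expansions.
    monomialOp-path : ∀ u {f g} {ν : Vec ℕ g} → InBox f ν → length u ℕ.+ (g ℕ.+ f) ≡ k →
      monomialOp O f ν (e (u ++ replicate g row ++ replicate f col)) ≈ e (u ++ path f ν)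
    monomialOp-path u [] l = refl
    monomialOp-path u {f} {suc g} {x ∷ ν} (x≤f ∷ β) l = begin
      apply O is (monomialOp O f ν (e (u ++ row ∷ replicate g row ++ replicate f col)))
        ≡⟨ ≡.cong (λ w → apply O is (monomialOp O f ν (e w))) (++-assoc u (row ∷ []) _) ⟨
      apply O is (monomialOp O f ν (e ((u ∷ʳ row) ++ replicate g row ++ replicate f col)))
        ≈⟨ apply-cong O O-cong is (monomialOp-path (u ∷ʳ row) β′ l′) ⟩
      apply O is (e ((u ∷ʳ row) ++ path f ν))
        ≡⟨ ≡.cong₂ (λ n w → apply O (applyUpTo (x ℕ.+ g ℕ.+ 1 ℕ.+_) n) (e w)) len
             (≡.trans (++-assoc u (row ∷ []) (path f ν)) (≡.cong (λ w → u ++ row ∷ w) path≡)) ⟩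
      apply O (applyUpTo (x ℕ.+ g ℕ.+ 1 ℕ.+_) (f ∸ x)) (e (u ++ row ∷ replicate (f ∸ x) col ++ path x ν))
        ≈⟨ apply-swaps u (f ∸ x) (path x ν) _ idx k≡ ⟩
      e (u ++ replicate (f ∸ x) col ++ row ∷ path x ν) ∎
      where
      is = [ x ℕ.+ g ℕ.+ 1 ⋯ f ℕ.+ g ]
      widen : ∀ {x f g} {ν : Vec ℕ g} → x ≤ f → InBox x ν → InBox f ν
      widen p []      = []
      widen p (q ∷ β) = ℕ.≤-trans q p ∷ β
      β′ = widen x≤f β
      l′ : length (u ∷ʳ row) ℕ.+ (g ℕ.+ f) ≡ k
      l′ = ≡.trans (≡.cong (ℕ._+ (g ℕ.+ f)) (length-++ u)) (≡.trans (ℕ.+-assoc (length u) 1 _) l)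
      len : suc (f ℕ.+ g) ∸ (x ℕ.+ g ℕ.+ 1) ≡ f ∸ x
      len = ≡.trans (≡.cong (suc (f ℕ.+ g) ∸_) (ℕ.+-comm (x ℕ.+ g) 1))
        (≡.trans (≡.cong₂ _∸_ (ℕ.+-comm f g) (ℕ.+-comm x g)) (ℕ.[m+n]∸[m+o]≡n∸o g f x))
      path≡ : path f ν ≡ replicate (f ∸ x) col ++ path x ν
      path≡ = ≡.trans (≡.cong (λ n → path n ν) (≡.sym (ℕ.m∸n+n≡m x≤f))) (path-+ (f ∸ x) β)
      length-path : ∀ {f g} {ν : Vec ℕ g} → InBox f ν → length (path f ν) ≡ f ℕ.+ g
      length-path {f} {ν = ν} β = ≡.trans (length-cols-rows (path f ν)) (≡.cong₂ ℕ._+_ (cols-path β) (rows-path ν))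
      idx : ∀ i → x ℕ.+ g ℕ.+ 1 ℕ.+ i ≡ suc (length (path x ν)) ℕ.+ i
      idx i = ≡.cong (ℕ._+ i) (≡.trans (ℕ.+-comm (x ℕ.+ g) 1) (≡.cong suc (≡.sym (length-path β))))
      k≡ : length (u ++ row ∷ replicate (f ∸ x) col ++ path x ν) ≡ k
      k≡ = ≡.trans (≡.cong (λ w → length (u ++ row ∷ w)) (≡.sym path≡)) (≡.trans (length-++ u)
        (≡.trans (≡.cong (λ n → length u ℕ.+ suc n) (≡.trans (length-path β′) (ℕ.+-comm f g))) l))

  ×ₙ-zero : ∀ n {x} → x ≈ 0# → n ×ₙ x ≈ 0#
  ×ₙ-zero zero    e = refl
  ×ₙ-zero (suc n) e = trans (+-cong e (×ₙ-zero n e)) (+-identityˡ 0#)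

-- Coxeter operators acting on the generator

record CoxeterOperators {c ℓ} (A : AbelianGroup c ℓ) (k : ℕ)
  (T : ℕ → AbelianGroup.Carrier A → AbelianGroup.Carrier A) : Set (c ⊔ ℓ) where
  open AbelianGroup A using (_≈_) renaming (_∙_ to _+_)
  field
    T-cong  : ∀ i {x y} → x ≈ y → T i x ≈ T i y
    T-+     : ∀ i x y → T i (x + y) ≈ T i x + T i y
    T-inv   : ∀ i x → T i (T i x) ≈ x
    T-comm  : ∀ {i j} x → 2 ℕ.+ i ≤ j → T i (T j x) ≈ T j (T i x)
    -- Outside the range 1 ≤ i < k the intended `T i` is the identity: still an involution that
    -- commutes with everything, but in conflict with the braid relation next to a genuine
    -- transposition.
    T-braid : ∀ {i} x → 1 ≤ i → suc i < k → T i (T (suc i) (T i x)) ≈ T (suc i) (T i (T (suc i) x))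

module CoxeterAction {c ℓ} {A : AbelianGroup c ℓ} {k : ℕ}
  {T : ℕ → AbelianGroup.Carrier A → AbelianGroup.Carrier A} (T-operators : CoxeterOperators A k T) where

  open CoxeterOperators T-operators
  open CupExpansion A
  open AbelianGroup A
    using (_≈_; _-_; _⁻¹; refl; sym; trans; reflexive; setoid; inverseʳ; inverseˡ; commutativeMonoid)
    renaming (Carrier to X; _∙_ to _+_; ε to 0#; ∙-congˡ to +-congˡ; identityˡ to +-identityˡ)
  open AbelianGroupProperties A using (identityˡ-unique; inverseˡ-unique)
  open Mult commutativeMonoid using (×-congʳ; ×-congˡ) renaming (_×_ to _×ₙ_)
  open SetoidReasoning setoid

  -- The defining relations of the generator of M^(p,q): `v` plays the part of the word of q rows
  -- followed by p cols.
  Fixed : ℕ → ℕ → X → Set _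
  Fixed p q v = ∀ i → 1 ≤ i → i < p ℕ.+ q → i ≢ p → T i v ≈ v

  fixed-pred : ∀ p q {v} → Fixed p (suc q) v → Fixed p q v
  fixed-pred p q h i 1≤i i< i≢p = h i 1≤i (ℕ.<-≤-trans i< (ℕ.+-monoʳ-≤ p (ℕ.n≤1+n q))) i≢p

  chain : ℕ → ℕ → X → X
  chain p zero    v = v
  chain p (suc q) v = T (suc (p ℕ.+ q)) (chain p q v)

  chain-cong : ∀ p q {x y} → x ≈ y → chain p q x ≈ chain p q y
  chain-cong p zero    e = e
  chain-cong p (suc q) e = T-cong _ (chain-cong p q e)

  chain-comm : ∀ p q {i} v → 2 ℕ.+ (p ℕ.+ q) ≤ i → T i (chain p q v) ≈ chain p q (T i v)
  chain-comm p zero    v l = refl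
  chain-comm p (suc q) {i} v l = trans (sym (T-comm _ l′)) (T-cong _ (chain-comm p q v (ℕ.<⇒≤ l′)))
    where
    l′ : 3 ℕ.+ (p ℕ.+ q) ≤ i
    l′ = ≡.subst (λ n → 2 ℕ.+ n ≤ i) (ℕ.+-suc p q) l

  -- With the leftmost col carried away, q rows and p cols remain. For i > p, `T i` commutes inward
  -- until it meets steps i + 1 and i of the chain; the braid relation turns it into `T (suc i)`,
  -- which slides through the rest and fixes `v`.
  chain-fixed : ∀ p q {v} → suc p ℕ.+ q ≤ k → Fixed (suc p) q v → Fixed p q (chain p q v)
  chain-fixed p zero l h i 1≤i i< i≢p = h i 1≤i (ℕ.m<n⇒m<1+n i<)
    λ { ≡.refl → ℕ.<-irrefl ≡.refl (ℕ.<-trans (ℕ.n<1+n p) (≡.subst (suc p <_) (ℕ.+-identityʳ p) i<)) }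
  chain-fixed p (suc q) {v} l h i 1≤i i< i≢p
    with ℕ.m≤n⇒m<n∨m≡n (s≤s⁻¹ (≡.subst (i <_) (ℕ.+-suc p q) i<))
  ... | inj₁ i<p+q = trans (T-comm _ (s≤s i<p+q)) (T-cong _
    (chain-fixed p q (ℕ.≤-trans (s≤s (ℕ.+-monoʳ-≤ p (ℕ.n≤1+n q))) l) (fixed-pred (suc p) q h) i 1≤i i<p+q i≢p))
  chain-fixed p (suc zero) l h _ _ _ i≢p | inj₂ ≡.refl = ⊥-elim (i≢p (ℕ.+-identityʳ p))
  chain-fixed p (suc (suc q)) {v} l h _ 1≤i _ _ | inj₂ ≡.refl
    rewrite ℕ.+-suc p (suc q) | ℕ.+-suc p q = begin
    T N (T (suc N) (T N (chain p q v)))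
      ≈⟨ T-braid _ 1≤i l ⟩
    T (suc N) (T N (T (suc N) (chain p q v)))
      ≈⟨ T-cong _ (T-cong _ (trans (chain-comm p q v ℕ.≤-refl)
           (chain-cong p q (h (suc N) (s≤s z≤n) ℕ.≤-refl λ e → ℕ.m≢1+m+n p (≡.sym (ℕ.suc-injective e)))))) ⟩
    T (suc N) (T N (chain p q v)) ∎
    where N = suc (p ℕ.+ q)

  chain-chain : ∀ p q {v} → 2 ℕ.+ (p ℕ.+ q) ≤ k → Fixed (2 ℕ.+ p) q v →
    T (suc (p ℕ.+ q)) (chain p q (chain (suc p) q v)) ≈ chain p q (chain (suc p) q v)
  chain-chain p zero l h = h (suc (p ℕ.+ 0)) (s≤s z≤n) ℕ.≤-refl
    λ e → ℕ.1+n≢n (≡.trans (≡.sym (ℕ.suc-injective e)) (ℕ.+-identityʳ p))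
  chain-chain p (suc q) {v} l h with h′ ← fixed-pred (2 ℕ.+ p) q h rewrite ℕ.+-suc p q = begin
    T (suc N) (T N (chain p q (T (suc N) y)))
      ≈⟨ T-cong _ (T-cong _ (chain-comm p q y ℕ.≤-refl)) ⟨
    T (suc N) (T N (T (suc N) (chain p q y)))
      ≈⟨ T-braid _ (s≤s z≤n) l ⟨
    T N (T (suc N) (T N (chain p q y)))
      ≈⟨ T-cong _ (T-cong _ (chain-chain p q (ℕ.<⇒≤ l) h′)) ⟩
    T N (T (suc N) (chain p q y))
      ≈⟨ T-cong _ (chain-comm p q y ℕ.≤-refl) ⟩
    T N (chain p q (T (suc N) y)) ∎
    where
    N = suc (p ℕ.+ q)
    y = chain (suc p) q v

  -- Builds w from row⋯row col⋯col, moving the leftmost col into place first;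
  -- place w m is t_μ m for the μ with boundary w.
  place : Word → X → X
  place []        v = v
  place (row ∷ w) v = place w v
  place (col ∷ w) v = place w (chain (cols w) (rows w) v)

  place-cong : ∀ w {x y} → x ≈ y → place w x ≈ place w y
  place-cong []        e = e
  place-cong (row ∷ w) e = place-cong w e
  place-cong (col ∷ w) e = place-cong w (chain-cong (cols w) (rows w) e)

  place-comm : ∀ w {i} v → suc (length w) ≤ i → T i (place w v) ≈ place w (T i v)
  place-comm []        v l = refl
  place-comm (row ∷ w) v l = place-comm w v (ℕ.<⇒≤ l)
  place-comm (col ∷ w) {i} v l = trans (place-comm w _ (ℕ.<⇒≤ l)) (place-cong w
    (chain-comm (cols w) (rows w) v (≡.subst (λ n → 2 ℕ.+ n ≤ i) (length-cols-rows w) l)))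

  -- The operators permute the letters of a word. Turning row col into col row is one more step of a
  -- chain, and the converse follows from `T-inv`. Equal letters must be fixed: for rows by the
  -- hypothesis on `v`, for cols by `chain-chain`.
  place-swap : ∀ u x y z v → length (u ++ x ∷ y ∷ z) ≤ k →
    Fixed (cols (u ++ x ∷ y ∷ z)) (rows (u ++ x ∷ y ∷ z)) v →
    T (suc (length z)) (place (u ++ x ∷ y ∷ z) v) ≈ place (u ++ y ∷ x ∷ z) v
  place-swap (row ∷ u) x y z v l h = place-swap u x y z v (ℕ.<⇒≤ l) (fixed-pred (cols (u ++ x ∷ y ∷ z)) _ h)
  place-swap (col ∷ u) x y z v l h = trans
    (place-swap u x y z _ (ℕ.<⇒≤ l) (chain-fixed (cols w) (rows w) (≡.subst (_≤ k) (≡.cong suc (length-cols-rows w)) l) h))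
    (reflexive (≡.cong₂ (λ p q → place (u ++ y ∷ x ∷ z) (chain p q v)) (cols-swap u x y z) (rows-swap u x y z)))
    where w = u ++ x ∷ y ∷ z
  place-swap [] x y z v l h = go x y l h
    where
    p = cols z
    q = rows z
    n≡ : length z ≡ p ℕ.+ q
    n≡ = length-cols-rows z
    row-col : T (suc (length z)) (place (row ∷ col ∷ z) v) ≈ place (col ∷ row ∷ z) v
    row-col = trans (place-comm z _ ℕ.≤-refl)
      (reflexive (≡.cong (λ n → place z (T (suc n) (chain p q v))) n≡))
    go : ∀ x y → 2 ℕ.+ length z ≤ k → Fixed (cols (x ∷ y ∷ z)) (rows (x ∷ y ∷ z)) v →
      T (suc (length z)) (place (x ∷ y ∷ z) v) ≈ place (y ∷ x ∷ z) v
    go row col l h = row-col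
    go col row l h = trans (T-cong _ (sym row-col)) (T-inv _ _)
    go row row l h = trans (place-comm z _ ℕ.≤-refl) (place-cong z
      (h (suc (length z)) (s≤s z≤n)
        (≡.subst (suc (length z) <_) (≡.trans (≡.cong (2 ℕ.+_) n≡)
          (≡.sym (≡.trans (ℕ.+-suc p (suc q)) (≡.cong suc (ℕ.+-suc p q))))) ℕ.≤-refl)
        λ e → ℕ.m≢1+m+n p (≡.sym (≡.trans (≡.cong suc (≡.sym n≡)) e))))
    go col col l h = trans (place-comm z _ ℕ.≤-refl) (place-cong z
      (trans (reflexive (≡.cong (λ n → T (suc n) (chain p q (chain (suc p) q v))) n≡))
        (chain-chain p q (≡.subst (λ n → 2 ℕ.+ n ≤ k) n≡ l) h)))

  T-0 : ∀ i → T i 0# ≈ 0#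
  T-0 i = identityˡ-unique (T i 0#) (T i 0#) (trans (sym (T-+ i 0# 0#)) (T-cong i (+-identityˡ 0#)))

  T-sub : ∀ i x y → T i (x - y) ≈ T i x - T i y
  T-sub i x y = trans (T-+ i x (y ⁻¹)) (+-congˡ (inverseˡ-unique (T i (y ⁻¹)) (T i y)
    (trans (sym (T-+ i (y ⁻¹) y)) (trans (T-cong i (inverseˡ y)) (T-0 i)))))

  S : ℕ → X → X
  S i x = T i x - x

  S-cong : ∀ i {x y} → x ≈ y → S i x ≈ S i y
  S-cong i e = sub-cong (T-cong i e) e

  module _ {f g : ℕ} (f+g≡k : f ℕ.+ g ≡ k) {m : X} (m-fixed : Fixed f g m) where

    -- Extended by zero off the shape (f, g), so that sums over all words of length f + g become
    -- sums over the box.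
    ψ : Word → X
    ψ w with (cols w ℕ.≟ f) ×-dec (rows w ℕ.≟ g)
    ... | yes _ = place w m
    ... | no  _ = 0#

    ψ-place : ∀ {w} → cols w ≡ f → rows w ≡ g → ψ w ≈ place w m
    ψ-place {w} p q with (cols w ℕ.≟ f) ×-dec (rows w ℕ.≟ g)
    ... | yes _ = refl
    ... | no ¬p = ⊥-elim (¬p (p , q))

    ψ-supported : Supported f g ψ
    ψ-supported w ¬p with (cols w ℕ.≟ f) ×-dec (rows w ℕ.≟ g)
    ... | yes p = ⊥-elim (¬p p)
    ... | no  _ = refl

    ψ-swap : ∀ u x y z → T (suc (length z)) (ψ (u ++ x ∷ y ∷ z)) ≈ ψ (u ++ y ∷ x ∷ z)
    ψ-swap u x y z with (cols (u ++ x ∷ y ∷ z) ℕ.≟ f) ×-dec (rows (u ++ x ∷ y ∷ z) ℕ.≟ g)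
    ... | yes (p , q) = trans
      (place-swap u x y z m (ℕ.≤-reflexive (≡.trans (length-cols-rows (u ++ x ∷ y ∷ z)) (≡.trans (≡.cong₂ ℕ._+_ p q) f+g≡k)))
        (≡.subst₂ (λ p q → Fixed p q m) (≡.sym p) (≡.sym q) m-fixed))
      (sym (ψ-place {u ++ y ∷ x ∷ z} (≡.trans (cols-swap u y x z) p) (≡.trans (rows-swap u y x z) q)))
    ... | no ¬p = trans (T-0 _) (sym (ψ-supported (u ++ y ∷ x ∷ z)
      λ (p , q) → ¬p (≡.trans (cols-swap u x y z) p , ≡.trans (rows-swap u x y z) q)))

    ψ-sorted : ψ (replicate g row ++ replicate f col) ≈ m
    ψ-sorted = trans (ψ-place {replicate g row ++ replicate f col} (cols-sorted g) (rows-sorted g)) (place-sorted g)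
      where
      cols-sorted : ∀ g → cols (replicate g row ++ replicate f col) ≡ f
      cols-sorted zero    = cols-path {f} []
      cols-sorted (suc g) = cols-sorted g
      rows-sorted : ∀ g → rows (replicate g row ++ replicate f col) ≡ g
      rows-sorted zero    = rows-path {f} []
      rows-sorted (suc g) = ≡.cong suc (rows-sorted g)
      place-cols : ∀ f → place (replicate f col) m ≈ m
      place-cols zero    = refl
      place-cols (suc f) = trans (reflexive (≡.cong (λ q → place (replicate f col) (chain (cols (replicate f col)) q m))
        (rows-path {f} []))) (place-cols f)
      place-sorted : ∀ g → place (replicate g row ++ replicate f col) m ≈ m
      place-sorted zero    = place-cols f
      place-sorted (suc g) = place-sorted g

    S-expand : ∀ i w → S i (expand [] w ψ) ≈ expand [] w (S i ∘ ψ)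
    S-expand i w = expand-hom (S i) (S-cong i) (trans (sub-cong (T-0 i) refl) (inverseʳ 0#))
      (λ x y → trans (sub-cong (T-sub i x y) refl) (sub-sub-interchange _ _ _ _)) [] w ψ

    expand-swap-S : ∀ u z → S (suc (length z)) (expand [] (u ++ row ∷ col ∷ z) ψ) ≈ expand [] (u ++ col ∷ row ∷ z) ψ
    expand-swap-S u z = trans (S-expand _ (u ++ row ∷ col ∷ z)) (expand-swap [] u z
      λ p x y q _ e → sub-cong (trans (reflexive (≡.cong (λ n → T (suc n) (ψ (p ++ x ∷ y ∷ q))) (≡.sym e))) (ψ-swap p x y q)) refl)

    expand-supported : ∀ w → ¬ (cols w ≡ f × rows w ≡ g) → expand [] w ψ ≈ 0#
    expand-supported w ¬p = expand-vanish [] w λ u p q → ψ-supported u λ (p′ , q′) →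
      ¬p (≡.trans (≡.sym (≡.trans p (ℕ.+-identityʳ _))) p′ , ≡.trans (≡.sym q) (≡.trans (ℕ.+-identityʳ _) q′))

    ∑-monomials : ∑ (𝒫 f g) (λ μ → monomialOp T f μ m) ≈ ∑ (𝒫 f g) (λ ν → F (toList ν) ×ₙ monomialOp S f ν m)
    ∑-monomials = begin
      ∑ (𝒫 f g) (λ μ → monomialOp T f μ m)
        ≈⟨ ∑-cong (All.map t-path (𝒫-inBox f g)) ⟩
      ∑ (𝒫 f g) (ψ ∘ path f)
        ≈⟨ ∑ʷ-𝒫 f g ψ ψ-supported ⟨
      ∑ʷ (f ℕ.+ g) ψ
        ≈⟨ ∑ʷ-expand (f ℕ.+ g) ψ ⟨
      ∑ʷ (f ℕ.+ g) (λ w → weight w ×ₙ expand [] w ψ)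
        ≈⟨ ∑ʷ-𝒫 f g _ (λ w ¬p → ×ₙ-zero (weight w) (expand-supported w ¬p)) ⟩
      ∑ (𝒫 f g) (λ ν → weight (path f ν) ×ₙ expand [] (path f ν) ψ)
        ≈⟨ ∑-cong (All.map s-path (𝒫-inBox f g)) ⟩
      ∑ (𝒫 f g) (λ ν → F (toList ν) ×ₙ monomialOp S f ν m) ∎
      where
      g+f≡k : g ℕ.+ f ≡ k
      g+f≡k = ≡.trans (ℕ.+-comm g f) f+g≡k
      t-path : ∀ {μ} → InBox f μ → monomialOp T f μ m ≈ ψ (path f μ)
      t-path {μ} β = trans (monomialOp-cong T T-cong f μ (sym ψ-sorted))
        (monomialOp-path k T T-cong ψ (λ u z _ → ψ-swap u row col z) [] β g+f≡k)
      s-path : ∀ {ν} → InBox f ν →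
        weight (path f ν) ×ₙ expand [] (path f ν) ψ ≈ F (toList ν) ×ₙ monomialOp S f ν m
      s-path {ν} β = trans (×-congˡ (≡.cong F (parts-path β))) (×-congʳ (F (toList ν)) (sym (trans
        (monomialOp-cong S S-cong f ν (sym (trans (expand-sorted g f ψ) ψ-sorted)))
        (monomialOp-path k S S-cong (λ w → expand [] w ψ) (λ u z _ → expand-swap-S u z) [] β g+f≡k))))

-- Coxeter relations in the symmetric group

transpose-iˡ : ∀ {n} (i j : Fin n) → PC.transpose i j i ≡ j
transpose-iˡ i j rewrite dec-true (i Fin.≟ i) ≡.refl = ≡.refl

transpose-jʳ : ∀ {n} (i j : Fin n) → PC.transpose i j j ≡ i
transpose-jʳ i j with j Fin.≟ i
... | yes j≡i = j≡i
... | no  _ rewrite dec-true (j Fin.≟ j) ≡.refl = ≡.refl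

transpose-other : ∀ {n} {i j x : Fin n} → x ≢ i → x ≢ j → PC.transpose i j x ≡ x
transpose-other {i = i} {j} {x} x≢i x≢j rewrite dec-false (x Fin.≟ i) x≢i | dec-false (x Fin.≟ j) x≢j = ≡.refl

-- All three relations come from conjugation: t_i sends its own transposition to itself, fixes the
-- points moved by a distant t_j, and t_i t_(i+1) conjugates t_i to t_(i+1).
transpose-conj : ∀ {n} (π : Permutation′ n) i j x →
  π ⟨$⟩ʳ PC.transpose i j x ≡ PC.transpose (π ⟨$⟩ʳ i) (π ⟨$⟩ʳ j) (π ⟨$⟩ʳ x)
transpose-conj π i j x = go (x Fin.≟ i) (x Fin.≟ j)
  where
  injective : ∀ {y z} → π ⟨$⟩ʳ y ≡ π ⟨$⟩ʳ z → y ≡ z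
  injective e = ≡.trans (≡.sym (Perm.inverseˡ π)) (≡.trans (≡.cong (π ⟨$⟩ˡ_) e) (Perm.inverseˡ π))
  go : Dec (x ≡ i) → Dec (x ≡ j) → π ⟨$⟩ʳ PC.transpose i j x ≡ PC.transpose (π ⟨$⟩ʳ i) (π ⟨$⟩ʳ j) (π ⟨$⟩ʳ x)
  go (yes ≡.refl) _            = ≡.trans (≡.cong (π ⟨$⟩ʳ_) (transpose-iˡ i j)) (≡.sym (transpose-iˡ (π ⟨$⟩ʳ i) (π ⟨$⟩ʳ j)))
  go (no _)       (yes ≡.refl) = ≡.trans (≡.cong (π ⟨$⟩ʳ_) (transpose-jʳ i j)) (≡.sym (transpose-jʳ (π ⟨$⟩ʳ i) (π ⟨$⟩ʳ j)))
  go (no x≢i)     (no x≢j)     = ≡.trans (≡.cong (π ⟨$⟩ʳ_) (transpose-other x≢i x≢j))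
    (≡.sym (transpose-other (x≢i ∘ injective) (x≢j ∘ injective)))

record IsAdjacent {k} (i : ℕ) (π : Permutation′ k) : Set where
  constructor adjacent
  field
    {a b} : Fin k
    a≡    : suc (toℕ a) ≡ i
    b≡    : toℕ b ≡ i
    π≡    : π ≡ Perm.transpose a b

coxeter-adjacent : ∀ {k i} → 1 ≤ i → i < k → IsAdjacent i (coxeter k i)
coxeter-adjacent {k} {suc j} _ i<k with suc j ℕ.<? k
... | yes p = adjacent (≡.cong suc (Fin.toℕ-fromℕ< _)) (Fin.toℕ-fromℕ< p) ≡.refl
... | no ¬p = ⊥-elim (¬p i<k)

coxeter-cases : ∀ k i → coxeter k i ≡ Perm.id ⊎ IsAdjacent i (coxeter k i)
coxeter-cases k zero    = inj₁ ≡.refl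
coxeter-cases k (suc j) with suc j ℕ.<? k
... | yes p = inj₂ (adjacent (≡.cong suc (Fin.toℕ-fromℕ< _)) (Fin.toℕ-fromℕ< p) ≡.refl)
... | no  _ = inj₁ ≡.refl

module _ {k : ℕ} where

  private
    τ : ℕ → Fin k → Fin k
    τ i = coxeter k i ⟨$⟩ʳ_

  coxeter-involutive : ∀ i x → τ i (τ i x) ≡ x
  coxeter-involutive i x with coxeter k i | coxeter-cases k i
  ... | _ | inj₁ ≡.refl = ≡.refl
  ... | _ | inj₂ (adjacent {a} {b} _ _ ≡.refl) = ≡.trans (transpose-conj (Perm.transpose a b) a b x)
    (≡.trans (≡.cong₂ (λ c d → PC.transpose c d (PC.transpose a b x)) (transpose-iˡ a b) (transpose-jʳ a b))
      (PC.transpose-inverse b a))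

  coxeter-comm : ∀ {i j} → 2 ℕ.+ i ≤ j → ∀ x → τ i (τ j x) ≡ τ j (τ i x)
  coxeter-comm {i} {j} i<j x
    with coxeter k i | coxeter-cases k i | coxeter k j | coxeter-cases k j
  ... | _ | inj₁ ≡.refl | _ | _           = ≡.refl
  ... | _ | inj₂ _      | _ | inj₁ ≡.refl = ≡.refl
  ... | _ | inj₂ (adjacent {a} {b} ≡.refl b≡ ≡.refl) | _ | inj₂ (adjacent {c} {d} ≡.refl d≡ ≡.refl) =
    ≡.trans (transpose-conj (Perm.transpose a b) c d x)
      (≡.cong₂ (λ y z → PC.transpose y z (PC.transpose a b x))
        (transpose-other (apart a<c) (apart b<c)) (transpose-other (apart a<d) (apart b<d)))
    where
    apart : ∀ {y z : Fin k} → toℕ y < toℕ z → z ≢ y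
    apart l ≡.refl = ℕ.<-irrefl ≡.refl l
    b<c : toℕ b < toℕ c
    b<c = ≡.subst (λ n → suc n ≤ toℕ c) (≡.sym b≡) (s≤s⁻¹ i<j)
    a<c : toℕ a < toℕ c
    a<c = ℕ.<⇒≤ (s≤s⁻¹ i<j)
    c<d : toℕ c < toℕ d
    c<d = ≡.subst (toℕ c <_) (≡.sym d≡) ℕ.≤-refl
    a<d = ℕ.<-trans a<c c<d
    b<d = ℕ.<-trans b<c c<d

  coxeter-braid : ∀ {i} → 1 ≤ i → suc i < k → ∀ x → τ i (τ (suc i) (τ i x)) ≡ τ (suc i) (τ i (τ (suc i) x))
  coxeter-braid {i} 1≤i i<k x
    with coxeter k i | coxeter-adjacent {k} {i} 1≤i (ℕ.<⇒≤ i<k)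
       | coxeter k (suc i) | coxeter-adjacent {k} {suc i} (s≤s z≤n) i<k
  ... | _ | adjacent {a} {b} a≡ b≡ ≡.refl | _ | adjacent {b′} {c} b′≡ c≡ ≡.refl
    with Fin.toℕ-injective (≡.trans (ℕ.suc-injective b′≡) (≡.sym b≡))
  ... | ≡.refl = ≡.trans (transpose-conj π a b x) (≡.cong₂ (λ y z → PC.transpose y z (π ⟨$⟩ʳ x)) πa πb)
    where
    π = Perm.transpose b c Perm.∘ₚ Perm.transpose a b
    a<b : toℕ a < toℕ b
    a<b = ≡.subst (_≤ toℕ b) (≡.sym a≡) (ℕ.≤-reflexive (≡.sym b≡))
    b<c : toℕ b < toℕ c
    b<c = ℕ.≤-reflexive (≡.trans b′≡ (≡.sym c≡))
    a≢b : a ≢ b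
    a≢b ≡.refl = ℕ.<-irrefl ≡.refl a<b
    b≢c : b ≢ c
    b≢c ≡.refl = ℕ.<-irrefl ≡.refl b<c
    a≢c : a ≢ c
    a≢c ≡.refl = ℕ.<-irrefl ≡.refl (ℕ.<-trans a<b b<c)
    πa : π ⟨$⟩ʳ a ≡ b
    πa = ≡.trans (≡.cong (PC.transpose a b) (transpose-other a≢b a≢c)) (transpose-iˡ a b)
    πb : π ⟨$⟩ʳ b ≡ c
    πb = ≡.trans (≡.cong (PC.transpose a b) (transpose-iˡ b c)) (transpose-other (a≢c ∘ ≡.sym) (b≢c ∘ ≡.sym))

-- Passage to the group algebra and its modules

module GroupAlgebraSingle {c ℓ c′ ℓ′} (R : CommutativeRing c ℓ) (G : Group c′ ℓ′) (_≟_ : Decidable (Group._≈_ G)) where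

  open GroupAlgebra R G _≟_
  private
    module R = CommutativeRing R
    module G = Group G

  single-cong : ∀ {r s σ π} → r R.≈ s → σ G.≈ π → single r σ ≈ single s π
  single-cong {σ = σ} {π} r≈s σ≈π h with σ ≟ h | π ≟ h
  ... | yes _ | yes _ = R.+-congʳ r≈s
  ... | no  _ | no  _ = R.refl
  ... | yes p | no q  = ⊥-elim (q (G.trans (G.sym σ≈π) p))
  ... | no p  | yes q = ⊥-elim (p (G.trans σ≈π q))

  single-0 : ∀ σ → single R.0# σ ≈ 0#
  single-0 σ h with σ ≟ h
  ... | yes _ = R.+-identityˡ R.0#
  ... | no  _ = R.+-identityˡ R.0#

  single-+ : ∀ r s σ → single (r R.+ s) σ ≈ single r σ + single s σ
  single-+ r s σ h with σ ≟ h
  ... | yes _ = R.+-assoc r s R.0#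
  ... | no  _ = R.sym (R.+-identityˡ _)

record CoxeterElements {r ℓ} (R : Ring r ℓ) (k : ℕ) (t : ℕ → Ring.Carrier R) : Set (r ⊔ ℓ) where
  open Ring R
  field
    t-inv   : ∀ i → t i * t i ≈ 1#
    t-comm  : ∀ {i j} → 2 ℕ.+ i ≤ j → t i * t j ≈ t j * t i
    t-braid : ∀ {i} → 1 ≤ i → suc i < k → t i * (t (suc i) * t i) ≈ t (suc i) * (t i * t (suc i))

module RingAction {r ℓr a ℓa} {R : Ring r ℓr} (M : LeftModule R a ℓa)
  {k : ℕ} {t : ℕ → Ring.Carrier R} (t-elements : CoxeterElements R k t) where

  open CoxeterElements t-elements
  open LeftModule M
  private
    module R = Ring R
    A = +ᴹ-abelianGroup
  open AbelianGroup A using (_-_)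
  open AbelianGroupProperties A using (inverseˡ-unique)
  open CupExpansion A
  open Mult +ᴹ-commutativeMonoid using (×-congʳ) renaming (_×_ to _×ₙ_)

  private
    T : ℕ → Carrierᴹ → Carrierᴹ
    T i x = t i *ₗ x

    T-inv : ∀ i x → T i (T i x) ≈ᴹ x
    T-inv i x = ≈ᴹ-trans (≈ᴹ-sym (*ₗ-assoc (t i) (t i) x)) (≈ᴹ-trans (*ₗ-congʳ (t-inv i)) (*ₗ-identityˡ x))

    T-comm : ∀ {i j} x → 2 ℕ.+ i ≤ j → T i (T j x) ≈ᴹ T j (T i x)
    T-comm {i} {j} x l = ≈ᴹ-trans (≈ᴹ-sym (*ₗ-assoc (t i) (t j) x))
      (≈ᴹ-trans (*ₗ-congʳ (t-comm l)) (*ₗ-assoc (t j) (t i) x))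

    T-braid : ∀ {i} x → 1 ≤ i → suc i < k → T i (T (suc i) (T i x)) ≈ᴹ T (suc i) (T i (T (suc i) x))
    T-braid {i} x 1≤i i<k = ≈ᴹ-trans (≈ᴹ-sym (assoc₃ i (suc i) i))
      (≈ᴹ-trans (*ₗ-congʳ (t-braid 1≤i i<k)) (assoc₃ (suc i) i (suc i)))
      where
      assoc₃ : ∀ h i j → (t h R.* (t i R.* t j)) *ₗ x ≈ᴹ T h (T i (T j x))
      assoc₃ h i j = ≈ᴹ-trans (*ₗ-assoc (t h) (t i R.* t j) x) (*ₗ-congˡ (*ₗ-assoc (t i) (t j) x))

    T-operators : CoxeterOperators A k T
    T-operators = record
      { T-cong  = λ i → *ₗ-congˡ
      ; T-+     = λ i → *ₗ-distribˡ (t i)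
      ; T-inv   = T-inv
      ; T-comm  = T-comm
      ; T-braid = T-braid
      }

  open CoxeterAction T-operators

  s : ℕ → R.Carrier
  s i = t i R.- R.1#

  neg-one-action : ∀ x → (R.- R.1#) *ₗ x ≈ᴹ -ᴹ x
  neg-one-action x = inverseˡ-unique _ _ (≈ᴹ-trans
    (+ᴹ-congˡ (≈ᴹ-sym (*ₗ-identityˡ x))) (≈ᴹ-trans (≈ᴹ-sym (*ₗ-distribʳ x (R.- R.1#) R.1#))
      (≈ᴹ-trans (*ₗ-congʳ (R.-‿inverseˡ R.1#)) (*ₗ-zeroˡ x))))

  s-action : ∀ i x → s i *ₗ x ≈ᴹ T i x - x
  s-action i x = ≈ᴹ-trans (*ₗ-distribʳ x (t i) (R.- R.1#)) (+ᴹ-congˡ (neg-one-action x))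

  ∏ : List R.Carrier → R.Carrier
  ∏ = foldr R._*_ R.1#

  -- Agrees by computation with the `factor` of `PermutationModule`, but the number of rows may vary
  -- while k stays fixed, so that `monomial-action` can peel off one row at a time.
  factor : (ℕ → R.Carrier) → ℕ → ∀ {g} → Vec ℕ g → Fin g → R.Carrier
  factor x f {g} ν r =
    let g-r = g ∸ suc (toℕ r)
    in ∏ (map x [ lookup ν r ℕ.+ g-r ℕ.+ 1 ⋯ f ℕ.+ g-r ])

  monomial : (ℕ → R.Carrier) → ℕ → ∀ {g} → Vec ℕ g → R.Carrier
  monomial x f {g} ν = ∏ (map (factor x f ν) (allFin g))

  ∏-action : ∀ x is v → ∏ (map x is) *ₗ v ≈ᴹ apply (λ i → x i *ₗ_) is v
  ∏-action x []       v = *ₗ-identityˡ v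
  ∏-action x (i ∷ is) v = ≈ᴹ-trans (*ₗ-assoc (x i) (∏ (map x is)) v) (*ₗ-congˡ (∏-action x is v))

  monomial-action : ∀ x f {g} (ν : Vec ℕ g) v → monomial x f ν *ₗ v ≈ᴹ monomialOp (λ i → x i *ₗ_) f ν v
  monomial-action x f ν v = ≈ᴹ-trans (≈ᴹ-reflexive (≡.cong (λ xs → ∏ xs *ₗ v) (map-tabulate id (factor x f ν)))) (go ν)
    where
    go : ∀ {n} (ν : Vec ℕ n) → ∏ (tabulate (factor x f ν)) *ₗ v ≈ᴹ monomialOp (λ i → x i *ₗ_) f ν v
    go [] = *ₗ-identityˡ v
    go {suc n} (y ∷ ν) = ≈ᴹ-trans (*ₗ-assoc _ _ v)
      (≈ᴹ-trans (*ₗ-congˡ (go ν)) (∏-action x [ y ℕ.+ n ℕ.+ 1 ⋯ f ℕ.+ n ] _))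

  module _ (ι : ℕ → R.Carrier) (ι-zero : ι 0 R.≈ R.0#) (ι-suc : ∀ n → ι (suc n) R.≈ R.1# R.+ ι n) where

    ι-action : ∀ n x → ι n *ₗ x ≈ᴹ n ×ₙ x
    ι-action zero    x = ≈ᴹ-trans (*ₗ-congʳ ι-zero) (*ₗ-zeroˡ x)
    ι-action (suc n) x = ≈ᴹ-trans (*ₗ-congʳ (ι-suc n))
      (≈ᴹ-trans (*ₗ-distribʳ x R.1# (ι n)) (+ᴹ-cong (*ₗ-identityˡ x) (ι-action n x)))

    ∑-t≈∑-s : ∀ {f g m} → f ℕ.+ g ≡ k → Fixed f g m →
      ∑ (𝒫 f g) (λ μ → monomial t f μ *ₗ m) ≈ᴹ ∑ (𝒫 f g) (λ ν → ι (F (toList ν)) *ₗ (monomial s f ν *ₗ m))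
    ∑-t≈∑-s {f} {g} {m} f+g≡k m-fixed = ≈ᴹ-trans
      (∑-cong (All.universal (λ μ → monomial-action t f μ m) (𝒫 f g)))
      (≈ᴹ-trans (∑-monomials f+g≡k m-fixed) (∑-cong (All.universal (λ ν → ≈ᴹ-sym (≈ᴹ-trans
        (ι-action (F (toList ν)) (monomial s f ν *ₗ m)) (×-congʳ (F (toList ν)) (≈ᴹ-trans (monomial-action s f ν m)
          (monomialOp-ext (λ i → s i *ₗ_) (λ i → *ₗ-congˡ) s-action f ν m))))) (𝒫 f g))))

theorem5p12 : ∀ {c ℓ} (𝔽 : Field c ℓ) (f g : ℕ) →
    let open PermutationModule 𝔽 f g
        open Partitions using (𝒫)
    in ∑ (𝒫 f g) (λ μ → t[ μ ] *ₗ m) ≈ᴹ ∑ (𝒫 f g) (λ ν → F𝔽 ν · (s[ ν ] *ₗ m))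
theorem5p12 𝔽 f g = ∑-t≈∑-s
    (λ n → single (n ×ₙ 𝔽.1#) Perm.id) (single-0 Perm.id) (λ n → single-+ 𝔽.1# (n ×ₙ 𝔽.1#) Perm.id)
    ≡.refl λ i 1≤i i<k i≢f → transᴹ (≈⇒≈ᴹ (Ring.*-identityʳ 𝔽𝔖ₖ (t i))) (relation (i , 1≤i , i<k , i≢f))
  where
  module 𝔽 = Field 𝔽
  open PermutationModule 𝔽 f g using (k; t; M; single; 𝔽𝔖ₖ; module Presentation)
  open Presentation using (relation; ≈⇒≈ᴹ; transᴹ)
  open SemiringMult 𝔽.semiring using () renaming (_×_ to _×ₙ_)
  open GroupAlgebraSingle 𝔽.commutativeRing (symmetricGroup k) _≟ₚ_
  τ : ℕ → Permutation′ k
  τ = coxeter k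
  infixl 7 _∙_
  _∙_ : Permutation′ k → Permutation′ k → Permutation′ k
  _∙_ = Group._∙_ (symmetricGroup k)
  t-elements : CoxeterElements 𝔽𝔖ₖ k t
  t-elements = record
    { t-inv   = λ i → single-cong {σ = τ i ∙ τ i} {Perm.id} (𝔽.*-identityˡ 𝔽.1#) (coxeter-involutive i)
    ; t-comm  = λ {i} {j} l → single-cong {σ = τ i ∙ τ j} {τ j ∙ τ i} 𝔽.refl (coxeter-comm l)
    ; t-braid = λ {i} 1≤i i<k → single-cong {σ = τ i ∙ (τ (suc i) ∙ τ i)} {τ (suc i) ∙ (τ i ∙ τ (suc i))} 𝔽.refl
        (coxeter-braid 1≤i i<k)
    }
  open RingAction M t-elements
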